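{- For any DAG $G=(V,E)$ there is a hyperplane arrangement $\mathcal{H}_G\subseteq\mathbb{R}^E$ such that for every $C\in\mathbb{R}^E\setminus\mathcal{H}_G$ the set $$\operatorname{cone}_G(C):=\{C'\in\mathbb{R}^E\setminus\mathcal{H}_G : \mathcal{M}_*(G,C)=\mathcal{M}_*(G,C')\}$$ is a full-dimensional open polyhedral cone. The collection of all closures of such cones for fixed $G$ (together with their faces) forms a complete polyhedral fan $\mathcal{F}_G$ in $\mathbb{R}^E$. Moreover, the map $\Phi$ which sends a cone of $\mathcal{F}_G$ to its maxoid is an inclusion-reversing surjection onto the set of maxoids $\{\mathcal{M}_*(G,C): C\in\mathbb{R}^E\}$ of $G$; here inclusion-reversing means that if $F_1,F_2\in\mathcal{F}_G$ and $F_1$ is a face of $F_2$, then $\Phi(F_1)\supseteq\Phi(F_2)$.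
   Context: Let $G=(V,E)$ be a finite DAG. $\mathbb{R}^E$ denotes the set of weight matrices supported on $G$: $V\times V$ matrices $C=(c_{ij})$ with $c_{ij}\in\mathbb{R}$ if $i\to j\in E$ and $c_{ij}=-\infty$ otherwise (identified with the Euclidean space indexed by $E$). For distinct $i,j\in V$, $P(i,j)$ is the set of directed paths from $i$ to $j$ in $G$, and the weight of a path $\pi$ is $\omega_C(\pi)=\sum_{e\in\pi}c_e$. A path in $P(i,j)$ is critical (for $(G,C)$) if its weight is maximal among all paths in $P(i,j)$. $C$ is generic if for all distinct $i,j$ with $P(i,j)\neq\emptyset$ there is exactly one critical path from $i$ to $j$. A hyperplane arrangement is a finite collection of linear hyperplanes, identified with the union of its members where it is treated as a subset of $\mathbb{R}^E$. The arrangement $\mathcal{H}_G$ meant in the claim is the one whose complement $\mathbb{R}^E\setminus\mathcal{H}_G$ is the set of generic weight matrices; its hyperplanes are given by equations of the form $\omega_C(\pi)=\omega_C(\pi')$ with distinct $\pi,\pi'\in P(i,j)$. For $L\subseteq V$, the critical DAG $G^*_{C,L}$ is the DAG on $V$ with an edge $i\to j$ ($i\neq j$) if and only if $P(i,j)\neq\emptyset$ and no critical path from $i$ to $j$ in $(G,C)$ has an interior node in $L$. Distinct $i,j\in V\setminus L$ are $C^*$-connected given $L$ if $G^*_{C,L}$ contains, up to exchanging $i$ and $j$, a path of one of the forms (a) $i\to j$; (b) $i\leftarrow p\to j$; (c) $i\to \ell\leftarrow j$; (d) $i\leftarrow p\to\ell\leftarrow j$; (e) $i\leftarrow p\to\ell\leftarrow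 q\to j$, with $\ell\in L$ and $p,q\notin L$. Otherwise they are $C^*$-separated given $L$. For pairwise disjoint $I,J,L\subseteq V$, $I$ and $J$ are $C^*$-separated given $L$ if every $i\in I$ and $j\in J$ are $C^*$-separated given $L$. The maxoid $\mathcal{M}_*(G,C)$ is the set of all CI statements $[I\perp\!\!\!\perp J\mid L]$ with $I,J,L$ pairwise disjoint such that $I$ and $J$ are $C^*$-separated given $L$ in $(G,C)$. An open polyhedral cone is a finite intersection of open linear half-spaces (possibly the whole space); a polyhedral cone is a finite intersection of closed linear half-spaces. Closures are Euclidean closures. A polyhedral fan is a finite collection of non-empty polyhedral cones closed under taking non-empty faces and such that the intersection of any two cones is a face of both; it is complete if its cones cover the space. The maxoid of a cone $F\in\mathcal{F}_G$ is $\Phi(F)=\mathcal{M}_*(G,C)$ for $C$ in the relative interior of $F$.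
   Formalization: As a subset of R^E, H_G is taken to be the part of each hyperplane ω(π)=ω(π′) where both paths are critical, so that its complement is exactly the generic matrices; with whole hyperplanes the claim fails once P(i,j) has three interior-disjoint paths. -}

module Defs where

open import Algebra.Bundles using (CommutativeRing)
import Algebra.Properties.Monoid.Sum as MonoidSum
open import Data.Fin.Base using (Fin)
open import Data.Fin.Subset using (Subset; _∈_; _∉_)
open import Data.List.Base using (List; []; _∷_)
import Data.List.Membership.Propositional as Membership
open import Data.List.Relation.Unary.All using (All)
open import Data.List.Relation.Unary.Any using (Any)
open import Data.Nat.Base using (ℕ)
open import Data.Product using (Σ; ∃; ∃₂; ∃!; _×_; _,_)
open import Data.Sum.Base using (_⊎_)
open import Data.Vec.Functional using (Vector)
open import Level using (0ℓ; suc)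
open import Relation.Binary.Construct.Closure.Transitive using (TransClosure; [_]; _∷_)
open import Relation.Binary.Core using (Rel)
open import Relation.Binary.PropositionalEquality.Core using (_≡_; _≢_)
open import Relation.Binary.Structures using (IsStrictTotalOrder)
open import Relation.Nullary.Negation.Core using (¬_)
open import Relation.Unary using (Pred; _≐_; _∩_; Satisfiable)

-- The real numbers, axiomatised as a (Dedekind-)complete ordered field; these
-- axioms determine ℝ up to isomorphism.  The supremum axiom is stated with
-- the approximation form of leastness (every y < sup S is exceeded by an
-- element of S), which is classically equivalent to "sup S is the least upper
-- bound".  Together with trichotomy it implies excluded middle for
-- propositions in Set: take the supremum of { 0 } ∪ { 1 | P }.
record RealNumbers : Set (suc 0ℓ) where
  field
    commutativeRing : CommutativeRing 0ℓ 0ℓ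
  open CommutativeRing commutativeRing public
  infix 4 _<_ _≤_
  field
    _<_                : Rel Carrier 0ℓ
    isStrictTotalOrder : IsStrictTotalOrder _≈_ _<_
    0<1                : 0# < 1#
    +-monoʳ-<          : ∀ x {y z} → y < z → x + y < x + z
    *-pos              : ∀ {x y} → 0# < x → 0# < y → 0# < x * y
    inverse            : ∀ x → ¬ (x ≈ 0#) → ∃ λ y → x * y ≈ 1#

  _≤_ : Rel Carrier 0ℓ
  x ≤ y = x < y ⊎ x ≈ y

  field
    supremum : (S : Pred Carrier 0ℓ) → Satisfiable S →
               (∃ λ b → ∀ {x} → S x → x ≤ b) →
               ∃ λ s → (∀ {x} → S x → x ≤ s) ×
                       (∀ {y} → y < s → ∃ λ x → S x × y < x)

-- The edges of a finite DAG are enumerated by Fin #E, so that ℝ^E is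
-- Vector ℝ #E; `simple` says that E is a subset of V × V.
record DAG : Set where
  field
    #V #E   : ℕ
    src tgt : Fin #E → Fin #V
    simple  : ∀ {e e′} → src e ≡ src e′ → tgt e ≡ tgt e′ → e ≡ e′

  V = Fin #V
  E = Fin #E

  _⟶_ : Rel V 0ℓ
  i ⟶ j = Σ E λ e → src e ≡ i × tgt e ≡ j

  -- Directed walks with at least one edge; by acyclicity no walk repeats a
  -- vertex, so these are exactly the directed paths between distinct vertices.
  Path : Rel V 0ℓ
  Path = TransClosure _⟶_

  field
    acyclic : ∀ {i} → ¬ Path i i

  interior : ∀ {i j} → Path i j → List V
  interior [ _ ]             = []
  interior (_∷_ {y = k} _ π) = k ∷ interior π

module Geometry (ℝ : RealNumbers) (m : ℕ) where
  open RealNumbers ℝ hiding (zero)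
  open MonoidSum +-monoid using (sum)

  Point : Set
  Point = Vector Carrier m

  ConeSet : Set (suc 0ℓ)
  ConeSet = Pred Point 0ℓ

  infix 7 _·_
  _·_ : Point → Point → Carrier
  a · x = sum (λ e → a e * x e)

  NonZeroVector : Pred Point 0ℓ
  NonZeroVector a = ¬ (∀ e → a e ≈ 0#)

  IsLinearHyperplane : ConeSet → Set
  IsLinearHyperplane S = ∃ λ a → NonZeroVector a × S ≐ (λ x → a · x ≈ 0#)

  IsOpenPolyhedralCone : ConeSet → Set
  IsOpenPolyhedralCone S =
    ∃ λ as → All NonZeroVector as × S ≐ (λ x → All (λ a → 0# < a · x) as)

  IsPolyhedralCone : ConeSet → Set
  IsPolyhedralCone S =
    ∃ λ as → All NonZeroVector as × S ≐ (λ x → All (λ a → 0# ≤ a · x) as)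

  AffineHull : ConeSet → ConeSet
  AffineHull S x =
    ∃ λ k → ∃₂ λ (c : Vector Carrier k) (p : Vector Point k) →
      (∀ r → S (p r)) × sum c ≈ 1# × (∀ e → x e ≈ sum (λ r → c r * p r e))

  FullDimensional : ConeSet → Set
  FullDimensional S = ∀ x → AffineHull S x

  -- ‖ x − y ‖ < ε, for ε > 0, with both sides squared
  Within : Carrier → Rel Point 0ℓ
  Within ε x y = sum (λ e → (x e - y e) * (x e - y e)) < ε * ε

  Closure : ConeSet → ConeSet
  Closure S x = ∀ {ε} → 0# < ε → ∃ λ y → S y × Within ε x y

  RelativeInterior : ConeSet → ConeSet
  RelativeInterior S x =
    S x × ∃ λ ε → 0# < ε × (∀ {y} → AffineHull S y → Within ε x y → S y)

  -- Faces are cut out by valid affine inequalities; S itself is a face of S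
  -- (u = 0, c = 0).
  _IsFaceOf_ : ConeSet → ConeSet → Set
  F IsFaceOf S =
    ∃₂ λ u c → (∀ {x} → S x → u · x ≤ c) × F ≐ (λ x → S x × u · x ≈ c)

  -- A collection of cones, closed under extensional equality of sets;
  -- finiteness is therefore meant up to extensional equality.
  record IsPolyhedralFan (𝓕 : Pred ConeSet 0ℓ) : Set (suc 0ℓ) where
    field
      finite       : ∃ λ Fs → All 𝓕 Fs × (∀ {F} → 𝓕 F → Any (F ≐_) Fs)
      cones        : ∀ {F} → 𝓕 F → IsPolyhedralCone F
      nonEmpty     : ∀ {F} → 𝓕 F → Satisfiable F
      faces        : ∀ {F F′} → 𝓕 F → F′ IsFaceOf F → Satisfiable F′ → 𝓕 F′
      intersection : ∀ {F₁ F₂} → 𝓕 F₁ → 𝓕 F₂ →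
                     (F₁ ∩ F₂) IsFaceOf F₁ × (F₁ ∩ F₂) IsFaceOf F₂

  IsComplete : Pred ConeSet 0ℓ → Set (suc 0ℓ)
  IsComplete 𝓕 = ∀ x → ∃ λ F → 𝓕 F × F x

module Maxoids (ℝ : RealNumbers) (G : DAG) where
  open RealNumbers ℝ hiding (zero)
  open DAG G public
  open Geometry ℝ #E public

  -- A point of ℝ^E; the entries −∞ off E never occur in a path weight.
  WeightMatrix : Set
  WeightMatrix = Point

  ω : ∀ {i j} → WeightMatrix → Path i j → Carrier
  ω C [ e , _ ]     = C e
  ω C ((e , _) ∷ π) = C e + ω C π

  Critical : ∀ {i j} → WeightMatrix → Path i j → Set
  Critical {i} {j} C π = ∀ (π′ : Path i j) → ω C π′ ≤ ω C π

  Generic : Pred WeightMatrix 0ℓ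
  Generic C = ∀ {i j} → i ≢ j → Path i j → ∃! _≡_ (λ (π : Path i j) → Critical C π)

  CriticalEdge : WeightMatrix → Subset #V → Rel V 0ℓ
  CriticalEdge C L i j =
    i ≢ j × Path i j ×
    (∀ (π : Path i j) → Critical C π → ∀ {k} → k Membership.∈ interior π → k ∉ L)

  data ConnectingPath (C : WeightMatrix) (L : Subset #V) (i j : V) : Set where
    form-a : CriticalEdge C L i j → ConnectingPath C L i j
    form-b : ∀ {p} → p ∉ L →
             CriticalEdge C L p i → CriticalEdge C L p j → ConnectingPath C L i j
    form-c : ∀ {l} → l ∈ L →
             CriticalEdge C L i l → CriticalEdge C L j l → ConnectingPath C L i j
    form-d : ∀ {p l} → p ∉ L → l ∈ L →
             CriticalEdge C L p i → CriticalEdge C L p l → CriticalEdge C L j l →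
             ConnectingPath C L i j
    form-e : ∀ {p l q} → p ∉ L → l ∈ L → q ∉ L →
             CriticalEdge C L p i → CriticalEdge C L p l →
             CriticalEdge C L q l → CriticalEdge C L q j → ConnectingPath C L i j

  C*-Connected : WeightMatrix → Subset #V → Rel V 0ℓ
  C*-Connected C L i j = ConnectingPath C L i j ⊎ ConnectingPath C L j i

  C*-Separated : WeightMatrix → Subset #V → Rel V 0ℓ
  C*-Separated C L i j = ¬ C*-Connected C L i j

  Disjoint : Rel (Subset #V) 0ℓ
  Disjoint I J = ∀ {v} → v ∈ I → v ∉ J

  record CIStatement : Set where
    field
      I J L    : Subset #V
      I∩J≡∅ : Disjoint I J
      I∩L≡∅ : Disjoint I L
      J∩L≡∅ : Disjoint J L

  𝓜* : WeightMatrix → Pred CIStatement 0ℓ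
  𝓜* C s = ∀ {i j} → i ∈ I → j ∈ J → C*-Separated C L i j
    where open CIStatement s

  record PathPair : Set where
    field
      {i j} : V
      i≢j   : i ≢ j
      π π′  : Path i j
      π≢π′  : π ≢ π′

  Hyperplane : PathPair → ConeSet
  Hyperplane h C = ω C π ≈ ω C π′
    where open PathPair h

  Arrangement : Set
  Arrangement = List PathPair

  -- The subset of ℝ^E whose complement consists of the generic matrices is not
  -- a union of whole hyperplanes when some P(i,j) contains three paths: at a
  -- point where ω(π) = ω(π′) is not the maximal weight, nothing need be tied.
  -- Each hyperplane therefore contributes only its part on which π and π′ are
  -- both critical.
  Locus : Arrangement → ConeSet
  Locus 𝓗 C = Any (λ h → Hyperplane h C × BothCritical h) 𝓗
    where
    BothCritical : PathPair → Set
    BothCritical h = Critical C π × Critical C π′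
      where open PathPair h

  module _ (𝓗 : Arrangement) where

    cone : WeightMatrix → ConeSet
    cone C C′ = ¬ Locus 𝓗 C′ × 𝓜* C ≐ 𝓜* C′

    -- The closures themselves are included, being faces of themselves.
    Fan : Pred ConeSet 0ℓ
    Fan F = ∃ λ C → ¬ Locus 𝓗 C × F IsFaceOf Closure (cone C) × Satisfiable F

  -- The maxoid common to all points of the relative interior of F.
  Φ : ConeSet → Pred CIStatement 0ℓ
  Φ F s = ∃ λ C → RelativeInterior F C × 𝓜* C s

{-# OPTIONS --safe #-}
module Submission where

-- Call the set of all matrices at which every critical path of C is still
-- critical the cell of C; its relative interior consists of the matrices with
-- exactly the critical paths of C.  The faces of a cell are again cells, and
-- D lies in the cell of a generic C obtained by perturbing D, so the cells of
-- all matrices are the cones of a complete fan.  Equal critical paths give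
-- equal maxoids.  Conversely, the maxoid of a generic matrix determines its
-- critical paths: if two critical paths from i to j have disjoint interiors and
-- k is a minimal node of these interiors, conditioning on k together with its
-- ancestors other than i separates i and j for one matrix and leaves them
-- connected for the other.

open import Defs
open import Data.Product.Base using (Σ; ∃; ∃₂; Σ-syntax; _×_; _,_; proj₁; proj₂; swap)
open import Function.Bundles using (_⇔_; mk⇔)
open import Level using (0ℓ)
open import Relation.Nullary.Negation.Core using (¬_; contradiction)
open import Relation.Unary using (_≐_; _⊆_; _∩_; _⊇_; Satisfiable)
open import Algebra.Bundles using (CommutativeRing)
import Algebra.Properties.CommutativeMonoid.Sum as CommutativeMonoidSum
import Algebra.Properties.Ring as RingProperties
import Algebra.Properties.Semiring.Mult.TCOptimised as SemiringMult
import Algebra.Properties.Semiring.Sum as SemiringSum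
import Algebra.Solver.Ring
open import Algebra.Solver.Ring.AlmostCommutativeRing
  using (fromCommutativeRing; _-Raw-AlmostCommutative⟶_)
open import Data.Bool.Base using (true; false; if_then_else_)
open import Data.Empty using (⊥; ⊥-elim)
open import Data.Fin.Base using (Fin; zero; suc)
import Data.Fin.Induction as Fin
import Data.Fin.Properties as Fin
open import Data.Fin.Subset as Subset using (Subset; ⁅_⁆)
import Data.Fin.Subset.Properties as Subset
open import Data.Integer.Base as ℤ using (ℤ; +_; -[1+_])
import Data.Integer.Properties as ℤ
open import Data.List.Base as List using (List; []; _∷_; concatMap; allFin)
import Data.List.Extrema as Extrema
open import Data.List.Membership.Propositional using (_∈_; lose)
open import Data.List.Membership.Propositional.Properties
  using (∈-allFin; ∈-map⁺; ∈-concatMap⁺; ∈-++⁺ˡ; ∈-++⁺ʳ; ∈-filter⁺; ∈-filter⁻)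
open import Data.List.Relation.Unary.All as All using (All; []; _∷_)
import Data.List.Relation.Unary.All.Properties as All
open import Data.List.Relation.Unary.Any using (Any; here; there; satisfied)
import Data.List.Relation.Unary.Any.Properties as Any
open import Data.Maybe.Base using (nothing; just)
open import Data.Nat.Base as ℕ using (ℕ; zero; suc)
import Data.Nat.Properties as ℕ
open import Data.Sum.Base using (_⊎_; inj₁; inj₂; [_,_]′)
import Data.Vec.Base as Vec
open import Data.Vec.Functional as Vector using (Vector)
import Data.Vec.Properties as Vec
open import Function.Base using (flip; _∘_; id)
open import Induction.WellFounded using (WellFounded; Acc; acc)
open import Relation.Binary.Bundles using (TotalOrder)
open import Relation.Binary.Construct.Closure.Transitive using ([_]; _∷_; _++_)
import Relation.Binary.Construct.StrictToNonStrict as ToNonStrict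
open import Relation.Binary.Definitions using (tri<; tri≈; tri>; WeaklyDecidable)
import Relation.Binary.PropositionalEquality as ≡
open ≡ using (_≡_; _≢_)
import Relation.Binary.Reasoning.Setoid as SetoidReasoning
open import Relation.Binary.Structures using (IsStrictTotalOrder; IsTotalOrder; IsStrictPartialOrder)
open import Relation.Nullary.Decidable using (Dec; yes; no; _×-dec_; does; dec-true)

-- Closures and faces are controlled by one fact about criticality: if two matrices lie in a common
-- cell, the paths critical for their sum, or for any combination with a positive factor, are
-- exactly those critical for both. Relative interiors are handled by prolonging segments slightly.
-- No duality theorem for polyhedra is invoked, since supporting functionals can be written down
-- from differences of path indicators. In the identification of critical paths from a maxoid, two
-- critical paths between the same nodes may well share interior nodes. Parts of a critical path are
-- critical, so such paths can be cut at a common node, and induction on the end points leaves only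
-- the disjoint case. Genericity enters on the connected side: an edge of the critical DAG requires
-- every critical path to avoid the conditioning set, and only one path can be kept under control.

module IntegerCoefficientSolver {c ℓ} (R : CommutativeRing c ℓ) where
  open CommutativeRing R hiding (zero)
  open RingProperties ring
  open SemiringMult semiring using ()
    renaming (_×_ to _⋆_; ×-homo-+ to ⋆-homo-+; ×1-homo-* to ⋆1-homo-*; 1+× to 1+⋆)
  open SetoidReasoning setoid

  -- Equality in an abstract ring does not compute, so the coefficients are integers, where equality
  -- is decidable and opposite terms cancel. With this optimised multiple, `fromℤ (+ 1)` reduces to
  -- `1#`, so `con (+ 1)` denotes `1#` definitionally.
  fromℤ : ℤ → Carrier
  fromℤ (+ n)    = n ⋆ 1#
  fromℤ -[1+ n ] = - (suc n ⋆ 1#)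

  fromℤ-⊖ : ∀ m n → fromℤ (m ℤ.⊖ n) ≈ m ⋆ 1# - n ⋆ 1#
  fromℤ-⊖ m zero = sym (trans (+-congˡ -0#≈0#) (+-identityʳ _))
  fromℤ-⊖ zero (suc n) = sym (+-identityˡ _)
  fromℤ-⊖ (suc m) (suc n) = begin
    fromℤ (suc m ℤ.⊖ suc n)                  ≡⟨ ≡.cong fromℤ (ℤ.[1+m]⊖[1+n]≡m⊖n m n) ⟩
    fromℤ (m ℤ.⊖ n)                          ≈⟨ fromℤ-⊖ m n ⟩
    m ⋆ 1# - n ⋆ 1#                          ≈⟨ +-congʳ (xyx⁻¹≈y 1# (m ⋆ 1#)) ⟨
    1# + m ⋆ 1# - 1# - n ⋆ 1#                ≈⟨ +-assoc _ _ _ ⟩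
    1# + m ⋆ 1# + (- 1# - n ⋆ 1#)            ≈⟨ +-congˡ (-‿+-comm 1# (n ⋆ 1#)) ⟩
    1# + m ⋆ 1# - (1# + n ⋆ 1#)              ≈⟨ +-cong (1+⋆ m 1#) (-‿cong (1+⋆ n 1#)) ⟨
    suc m ⋆ 1# - suc n ⋆ 1#                  ∎

  fromℤ-homo-neg : ∀ i → fromℤ (ℤ.- i) ≈ - fromℤ i
  fromℤ-homo-neg (+ zero)  = sym -0#≈0#
  fromℤ-homo-neg (+ suc n) = refl
  fromℤ-homo-neg -[1+ n ]  = sym (-‿involutive _)

  fromℤ-homo-+ : ∀ i j → fromℤ (i ℤ.+ j) ≈ fromℤ i + fromℤ j
  fromℤ-homo-+ (+ m)    (+ n)    = ⋆-homo-+ 1# m n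
  fromℤ-homo-+ (+ m)    -[1+ n ] = fromℤ-⊖ m (suc n)
  fromℤ-homo-+ -[1+ m ] (+ n)    = trans (fromℤ-⊖ n (suc m)) (+-comm _ _)
  fromℤ-homo-+ -[1+ m ] -[1+ n ] = begin
    - (suc (suc (m ℕ.+ n)) ⋆ 1#)        ≡⟨ ≡.cong (λ k → - (suc k ⋆ 1#)) (ℕ.+-suc m n) ⟨
    - ((suc m ℕ.+ suc n) ⋆ 1#)          ≈⟨ -‿cong (⋆-homo-+ 1# (suc m) (suc n)) ⟩
    - (suc m ⋆ 1# + suc n ⋆ 1#)         ≈⟨ -‿+-comm _ _ ⟨
    - (suc m ⋆ 1#) - suc n ⋆ 1#         ∎

  fromℤ-homo-*⁺ : ∀ m j → fromℤ (+ m ℤ.* j) ≈ m ⋆ 1# * fromℤ j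
  fromℤ-homo-*⁺ m (+ n) = begin
    fromℤ (+ m ℤ.* + n)   ≡⟨ ≡.cong fromℤ (ℤ.pos-* m n) ⟨
    (m ℕ.* n) ⋆ 1#        ≈⟨ ⋆1-homo-* m n ⟩
    m ⋆ 1# * n ⋆ 1#       ∎
  fromℤ-homo-*⁺ m -[1+ n ] = begin
    fromℤ (+ m ℤ.* -[1+ n ])      ≡⟨ ≡.cong fromℤ (ℤ.neg-distribʳ-* (+ m) (+ suc n)) ⟨
    fromℤ (ℤ.- (+ m ℤ.* + suc n)) ≈⟨ fromℤ-homo-neg (+ m ℤ.* + suc n) ⟩
    - fromℤ (+ m ℤ.* + suc n)     ≈⟨ -‿cong (fromℤ-homo-*⁺ m (+ suc n)) ⟩
    - (m ⋆ 1# * suc n ⋆ 1#)       ≈⟨ -‿distribʳ-* _ _ ⟩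
    m ⋆ 1# * - (suc n ⋆ 1#)       ∎

  fromℤ-homo-* : ∀ i j → fromℤ (i ℤ.* j) ≈ fromℤ i * fromℤ j
  fromℤ-homo-* (+ m)    j = fromℤ-homo-*⁺ m j
  fromℤ-homo-* -[1+ m ] j = begin
    fromℤ (-[1+ m ] ℤ.* j)        ≡⟨ ≡.cong fromℤ (ℤ.neg-distribˡ-* (+ suc m) j) ⟨
    fromℤ (ℤ.- (+ suc m ℤ.* j))   ≈⟨ fromℤ-homo-neg (+ suc m ℤ.* j) ⟩
    - fromℤ (+ suc m ℤ.* j)       ≈⟨ -‿cong (fromℤ-homo-*⁺ (suc m) j) ⟩
    - (suc m ⋆ 1# * fromℤ j)      ≈⟨ -‿distribˡ-* _ _ ⟩
    - (suc m ⋆ 1#) * fromℤ j      ∎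

  morphism : ℤ.+-*-rawRing -Raw-AlmostCommutative⟶ fromCommutativeRing R
  morphism = record
    { ⟦_⟧    = fromℤ
    ; +-homo = fromℤ-homo-+
    ; *-homo = fromℤ-homo-*
    ; -‿homo = fromℤ-homo-neg
    ; 0-homo = refl
    ; 1-homo = refl
    }

  _≟ᶜ_ : WeaklyDecidable (λ i j → fromℤ i ≈ fromℤ j)
  i ≟ᶜ j with i ℤ.≟ j
  ... | yes i≡j = just (reflexive (≡.cong fromℤ i≡j))
  ... | no  _   = nothing

  open Algebra.Solver.Ring ℤ.+-*-rawRing (fromCommutativeRing R) morphism _≟ᶜ_ public
    using (solve; _:=_; _:+_; _:*_; _:-_; :-_; con)

-- Inequalities in an ordered field and small positive parameters

module RealProperties (ℝ : RealNumbers) where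
  open RealNumbers ℝ hiding (zero)
  open IsStrictTotalOrder isStrictTotalOrder public
    using (compare; <-respˡ-≈; <-respʳ-≈; irrefl)
    renaming (trans to <-trans)
  open IntegerCoefficientSolver commutativeRing public
  open IsTotalOrder (ToNonStrict.isTotalOrder _≈_ _<_ isStrictTotalOrder) public
    using (≤-respˡ-≈; ≤-respʳ-≈)
    renaming (refl to ≤-refl; trans to ≤-trans; antisym to ≤-antisym;
      reflexive to ≤-reflexive; total to ≤-total)

  -- "For all sufficiently small positive t". Asking for a whole interval makes the notion stable
  -- under finite conjunction, so one `t` can serve finitely many strict inequalities.
  Small : (Carrier → Set) → Set
  Small P = ∃ λ δ → 0# < δ × (∀ {t} → 0# < t → t ≤ δ → P t)

  abstract
    <-≤-trans : ∀ {x y z} → x < y → y ≤ z → x < z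
    <-≤-trans = ToNonStrict.<-≤-trans _≈_ _<_ <-trans <-respʳ-≈

    ≤-<-trans : ∀ {x y z} → x ≤ y → y < z → x < z
    ≤-<-trans = ToNonStrict.≤-<-trans _≈_ _<_ sym <-trans <-respˡ-≈

    <⇒≤ : ∀ {x y} → x < y → x ≤ y
    <⇒≤ = inj₁

    <⇒≱ : ∀ {x y} → x < y → ¬ (y ≤ x)
    <⇒≱ x<y y≤x = irrefl refl (<-≤-trans x<y y≤x)

    ≰⇒> : ∀ {x y} → ¬ (x ≤ y) → y < x
    ≰⇒> {x} {y} x≰y with compare x y
    ... | tri< x<y _ _ = contradiction (inj₁ x<y) x≰y
    ... | tri≈ _ x≈y _ = contradiction (inj₂ x≈y) x≰y
    ... | tri> _ _ y<x = y<x

    ≮⇒≥ : ∀ {x y} → ¬ (x < y) → y ≤ x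
    ≮⇒≥ {x} {y} x≮y with compare x y
    ... | tri< x<y _ _ = contradiction x<y x≮y
    ... | tri≈ _ x≈y _ = inj₂ (sym x≈y)
    ... | tri> _ _ y<x = inj₁ y<x

    excludedMiddle : (P : Set) → Dec P
    excludedMiddle P with supremum (λ x → x ≈ 0# ⊎ (x ≈ 1# × P)) (0# , inj₁ refl)
        (1# , [ (λ x≈0 → inj₁ (<-respˡ-≈ (sym x≈0) 0<1)) , (λ (x≈1 , _) → inj₂ x≈1) ]′)
    ... | s , upper , least with compare 0# s
    ...   | tri< 0<s _ _ with least 0<s
    ...     | x , inj₁ x≈0 , 0<x = contradiction 0<x (irrefl (sym x≈0))
    ...     | x , inj₂ (_ , p) , _ = yes p
    excludedMiddle P | s , upper , least | tri≈ 0≮s _ _ =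
      no λ p → 0≮s (<-≤-trans 0<1 (upper (inj₂ (refl , p))))
    excludedMiddle P | s , upper , least | tri> 0≮s _ _ =
      no λ p → 0≮s (<-≤-trans 0<1 (upper (inj₂ (refl , p))))

    +-monoˡ-< : ∀ x {y z} → y < z → y + x < z + x
    +-monoˡ-< x y<z = <-respˡ-≈ (+-comm _ _) (<-respʳ-≈ (+-comm _ _) (+-monoʳ-< x y<z))

    x<y⇒0<y-x : ∀ {x y} → x < y → 0# < y - x
    x<y⇒0<y-x {x} x<y = <-respˡ-≈ (-‿inverseʳ x) (+-monoˡ-< (- x) x<y)

    0<y-x⇒x<y : ∀ {x y} → 0# < y - x → x < y
    0<y-x⇒x<y {x} {y} 0<y-x = <-respˡ-≈ (+-identityʳ x)
      (<-respʳ-≈ (solve 2 (λ x y → x :+ (y :- x) := y) refl x y) (+-monoʳ-< x 0<y-x))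

    x≤y⇒0≤y-x : ∀ {x y} → x ≤ y → 0# ≤ y - x
    x≤y⇒0≤y-x (inj₁ x<y) = inj₁ (x<y⇒0<y-x x<y)
    x≤y⇒0≤y-x {x} (inj₂ x≈y) = inj₂ (trans (sym (-‿inverseʳ x)) (+-congʳ x≈y))

    0≤y-x⇒x≤y : ∀ {x y} → 0# ≤ y - x → x ≤ y
    0≤y-x⇒x≤y (inj₁ 0<y-x) = inj₁ (0<y-x⇒x<y 0<y-x)
    0≤y-x⇒x≤y {x} {y} (inj₂ 0≈y-x) = inj₂ (trans (sym (+-identityʳ x))
      (trans (+-congˡ 0≈y-x) (solve 2 (λ x y → x :+ (y :- x) := y) refl x y)))

    x-y≈0⇒x≈y : ∀ {x y} → x - y ≈ 0# → x ≈ y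
    x-y≈0⇒x≈y {x} {y} x-y≈0 = trans (solve 2 (λ x y → x := y :+ (x :- y)) refl x y)
      (trans (+-congˡ x-y≈0) (+-identityʳ y))

    +-pos : ∀ {x y} → 0# < x → 0# < y → 0# < x + y
    +-pos {x} 0<x 0<y = <-trans 0<x (<-respˡ-≈ (+-identityʳ x) (+-monoʳ-< x 0<y))

    +-pos-nonneg : ∀ {x y} → 0# < x → 0# ≤ y → 0# < x + y
    +-pos-nonneg 0<x (inj₁ 0<y) = +-pos 0<x 0<y
    +-pos-nonneg {x} 0<x (inj₂ 0≈y) = <-respʳ-≈ (trans (sym (+-identityʳ x)) (+-congˡ 0≈y)) 0<x

    +-nonneg-pos : ∀ {x y} → 0# ≤ x → 0# < y → 0# < x + y
    +-nonneg-pos 0≤x 0<y = <-respʳ-≈ (+-comm _ _) (+-pos-nonneg 0<y 0≤x)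

    +-nonneg : ∀ {x y} → 0# ≤ x → 0# ≤ y → 0# ≤ x + y
    +-nonneg (inj₁ 0<x) 0≤y = inj₁ (+-pos-nonneg 0<x 0≤y)
    +-nonneg {x} {y} (inj₂ 0≈x) 0≤y = ≤-respʳ-≈ (trans (sym (+-identityˡ y)) (+-congʳ 0≈x)) 0≤y

    *-nonneg : ∀ {x y} → 0# ≤ x → 0# ≤ y → 0# ≤ x * y
    *-nonneg (inj₁ 0<x) (inj₁ 0<y) = inj₁ (*-pos 0<x 0<y)
    *-nonneg {y = y} (inj₂ 0≈x) _ = inj₂ (trans (sym (zeroˡ y)) (*-congʳ 0≈x))
    *-nonneg {x = x} (inj₁ _) (inj₂ 0≈y) = inj₂ (trans (sym (zeroʳ x)) (*-congˡ 0≈y))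

    square-pos : ∀ {x} → ¬ (x ≈ 0#) → 0# < x * x
    square-pos {x} x≉0 with compare 0# x
    ... | tri< 0<x _ _ = *-pos 0<x 0<x
    ... | tri≈ _ 0≈x _ = contradiction (sym 0≈x) x≉0
    ... | tri> _ _ x<0 = <-respʳ-≈
                           (solve 1 (λ x → (con (+ 0) :- x) :* (con (+ 0) :- x) := x :* x) refl x)
                           (*-pos (x<y⇒0<y-x x<0) (x<y⇒0<y-x x<0))

    square-nonneg : ∀ x → 0# ≤ x * x
    square-nonneg x with excludedMiddle (x ≈ 0#)
    ... | yes x≈0 = inj₂ (sym (trans (*-congˡ x≈0) (zeroʳ x)))
    ... | no  x≉0 = inj₁ (square-pos x≉0)

    inverse-pos : ∀ {x} → 0# < x → ∃ λ y → 0# < y × x * y ≈ 1#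
    inverse-pos {x} 0<x with inverse x (λ x≈0 → irrefl (sym x≈0) 0<x)
    ... | y , xy≈1 = y , ≰⇒> y≰0 , xy≈1
      where
      y≰0 : ¬ (y ≤ 0#)
      y≰0 y≤0 = <⇒≱ 0<1 (0≤y-x⇒x≤y (≤-respʳ-≈
        (trans (solve 2 (λ x y → x :* (con (+ 0) :- y) := con (+ 0) :- x :* y) refl x y)
          (+-congˡ (-‿cong xy≈1)))
        (*-nonneg (<⇒≤ 0<x) (x≤y⇒0≤y-x y≤0))))

    minimum : ∀ {x y} → 0# < x → 0# < y → ∃ λ z → 0# < z × z ≤ x × z ≤ y
    minimum {x} {y} 0<x 0<y with ≤-total x y
    ... | inj₁ x≤y = x , 0<x , ≤-refl , x≤y
    ... | inj₂ y≤x = y , 0<y , y≤x , ≤-refl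

    small-∩ : ∀ {P Q} → Small P → Small Q → Small (λ t → P t × Q t)
    small-∩ (δ , 0<δ , p) (δ′ , 0<δ′ , q) with minimum 0<δ 0<δ′
    ... | m , 0<m , m≤δ , m≤δ′ = m , 0<m ,
      λ 0<t t≤m → p 0<t (≤-trans t≤m m≤δ) , q 0<t (≤-trans t≤m m≤δ′)

    small-All : ∀ {A : Set} {P : A → Carrier → Set} → (∀ a → Small (P a)) →
                ∀ as → Small (λ t → All (λ a → P a t) as)
    small-All s [] = 1# , 0<1 , λ _ _ → []
    small-All s (a ∷ as) with small-∩ (s a) (small-All s as)
    ... | δ , 0<δ , p = δ , 0<δ , λ 0<t t≤δ → let (h , hs) = p 0<t t≤δ in h ∷ hs

    small-map : ∀ {P Q : Carrier → Set} → (∀ {t} → 0# < t → P t → Q t) → Small P → Small Q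
    small-map f (δ , 0<δ , p) = δ , 0<δ , λ 0<t t≤δ → f 0<t (p 0<t t≤δ)

    small-witness : ∀ {P} → Small P → ∃ λ t → 0# < t × P t
    small-witness (δ , 0<δ , p) = δ , 0<δ , p 0<δ ≤-refl

    -- For p - q > 0 the threshold δ is p / (p - q): then p + t q ≥ t p for t ≤ δ.
    small-perturbation : ∀ {p} q → 0# < p → Small (λ t → 0# < p + t * q)
    small-perturbation {p} q 0<p with excludedMiddle (0# < p - q)
    ... | no  p≤q = 1# , 0<1 , λ 0<t _ → +-pos-nonneg 0<p
            (*-nonneg (<⇒≤ 0<t) (≤-trans (<⇒≤ 0<p) (≮⇒≥ λ q<p → p≤q (x<y⇒0<y-x q<p))))
    ... | yes 0<p-q with inverse-pos 0<p-q
    ...   | r , 0<r , [p-q]r≈1 = p * r , *-pos 0<p 0<r , λ {t} 0<t t≤pr →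
            <-respʳ-≈ (trans (solve 4 (λ p q r t →
                t :* p :+ (p :* r :- t) :* (p :- q) := p :* ((p :- q) :* r) :+ (t :* q)) refl p q r t)
                (+-congʳ (trans (*-congˡ [p-q]r≈1) (*-identityʳ p))))
              (+-pos-nonneg (*-pos 0<t 0<p) (*-nonneg (x≤y⇒0≤y-x t≤pr) (<⇒≤ 0<p-q)))

-- Inner products, affine hulls and relative interiors

module GeometryProperties (ℝ : RealNumbers) (m : ℕ) where
  open RealNumbers ℝ hiding (zero)
  open RealProperties ℝ
  open Geometry ℝ m
  open SetoidReasoning setoid
  open CommutativeMonoidSum +-commutativeMonoid using (sum; sum-cong-≋; ∑-distrib-+)
  open SemiringSum semiring using (*-distribˡ-sum)

  sum-nonneg : ∀ {n} {f : Vector Carrier n} → (∀ e → 0# ≤ f e) → 0# ≤ sum f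
  sum-nonneg {ℕ.zero} _ = ≤-refl
  sum-nonneg {ℕ.suc n} 0≤f = +-nonneg (0≤f zero) (sum-nonneg (λ e → 0≤f (suc e)))

  term≤sum : ∀ {n} {f : Vector Carrier n} → (∀ e → 0# ≤ f e) → ∀ e → f e ≤ sum f
  term≤sum {f = f} 0≤f zero = 0≤y-x⇒x≤y (≤-respʳ-≈
    (solve 2 (λ x y → y := x :+ y :- x) refl (f zero) _) (sum-nonneg (λ e → 0≤f (suc e))))
  term≤sum {f = f} 0≤f (suc e) = ≤-trans (term≤sum (λ e → 0≤f (suc e)) e)
    (0≤y-x⇒x≤y (≤-respʳ-≈ (solve 2 (λ x y → x := x :+ y :- y) refl (f zero) _) (0≤f zero)))

  infixl 6 _+[_]_
  _+[_]_ : Point → Carrier → Point → Point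
  (x +[ t ] v) e = x e + t * v e

  ·-comm : ∀ a x → a · x ≈ x · a
  ·-comm a x = sum-cong-≋ (λ e → *-comm (a e) (x e))

  ·-linearʳ : ∀ a x t v → a · (x +[ t ] v) ≈ a · x + t * (a · v)
  ·-linearʳ a x t v = begin
    a · (x +[ t ] v)                          ≈⟨ sum-cong-≋ (λ e → solve 4
      (λ a x t v → a :* (x :+ t :* v) := a :* x :+ t :* (a :* v)) refl (a e) (x e) t (v e)) ⟩
    sum (λ e → a e * x e + t * (a e * v e))   ≈⟨ ∑-distrib-+ (λ e → a e * x e) (λ e → t * (a e * v e)) ⟩
    a · x + sum (λ e → t * (a e * v e))       ≈⟨ +-congˡ (*-distribˡ-sum t (λ e → a e * v e)) ⟨
    a · x + t * (a · v)                       ∎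

  ·-linearˡ : ∀ a t b x → (a +[ t ] b) · x ≈ a · x + t * (b · x)
  ·-linearˡ a t b x = begin
    (a +[ t ] b) · x          ≈⟨ ·-comm _ x ⟩
    x · (a +[ t ] b)          ≈⟨ ·-linearʳ x a t b ⟩
    x · a + t * (x · b)       ≈⟨ +-cong (·-comm x a) (*-congˡ (·-comm x b)) ⟩
    a · x + t * (b · x)       ∎

  x·x-pos : ∀ {x} → NonZeroVector x → 0# < x · x
  x·x-pos {x} x≉0 = ≰⇒> λ x·x≤0 → x≉0 λ e → coordinate≈0 x·x≤0 e
    where
    coordinate≈0 : x · x ≤ 0# → ∀ e → x e ≈ 0#
    coordinate≈0 x·x≤0 e with excludedMiddle (x e ≈ 0#)
    ... | yes xe≈0 = xe≈0
    ... | no  xe≉0 = contradiction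
      (≤-trans (term≤sum {f = λ e → x e * x e} (λ e → square-nonneg (x e)) e) x·x≤0)
      (<⇒≱ (square-pos xe≉0))

  within-sym : ∀ {ε x y} → Within ε x y → Within ε y x
  within-sym {x = x} {y} = <-respˡ-≈ (sum-cong-≋ (λ e → solve 2
    (λ x y → (x :- y) :* (x :- y) := (y :- x) :* (y :- x)) refl (x e) (y e)))

  within-coordinate : ∀ {ε x y} → 0# < ε → Within ε x y → ∀ e → x e < y e + ε
  within-coordinate {ε} {x} {y} 0<ε near e = ≰⇒> λ y+ε≤x →
    let d = x e - y e
        ε≤d = x≤y⇒0≤y-x y+ε≤x
    in <⇒≱ (≤-<-trans (term≤sum {f = λ e → (x e - y e) * (x e - y e)} (λ e → square-nonneg _) e) near)
         -- With r = x e - (y e + ε), which is nonnegative here, the difference of the squares of x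
         -- e - y e and ε is r (r + 2ε).
         (0≤y-x⇒x≤y (≤-respʳ-≈ (solve 3 (λ x y ε →
             (x :- (y :+ ε)) :* (x :- (y :+ ε) :+ (ε :+ ε)) := (x :- y) :* (x :- y) :- ε :* ε)
             refl (x e) (y e) ε)
           (*-nonneg ε≤d (+-nonneg ε≤d (<⇒≤ (+-pos 0<ε 0<ε))))))

  -- The condition is quadratic in t, while `small-perturbation` treats linear bounds; t (v · v) <
  -- ε² together with t < 1 implies t² (v · v) < ε².
  within-small : ∀ {ε} x v → 0# < ε → Small (λ t → Within ε x (x +[ t ] v))
  within-small {ε} x v 0<ε = small-map near
    (small-∩ (small-perturbation (- (v · v)) (*-pos 0<ε 0<ε)) (small-perturbation (- 1#) 0<1))
    where
    near : ∀ {t} → 0# < t → 0# < ε * ε + t * - (v · v) × 0# < 1# + t * - 1# → Within ε x (x +[ t ] v)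
    near {t} 0<t (bound , t<1) = 0<y-x⇒x<y (<-respʳ-≈ eq
      (+-pos-nonneg bound (*-nonneg (*-nonneg (<⇒≤ 0<t) (sum-nonneg (λ e → square-nonneg (v e)))) (<⇒≤ t<1))))
      where
      eq : ε * ε + t * - (v · v) + t * (v · v) * (1# + t * - 1#) ≈
           ε * ε - sum (λ e → (x e - (x +[ t ] v) e) * (x e - (x +[ t ] v) e))
      eq = begin
        _  ≈⟨ solve 3 (λ ε t s → ε :* ε :+ t :* :- s :+ t :* s :* (con (+ 1) :+ t :* :- con (+ 1)) :=
                ε :* ε :- t :* t :* s) refl ε t (v · v) ⟩
        ε * ε - t * t * (v · v) ≈⟨ +-congˡ (-‿cong (*-distribˡ-sum (t * t) (λ e → v e * v e))) ⟩
        ε * ε - sum (λ e → t * t * (v e * v e)) ≈⟨ +-congˡ (-‿cong (sum-cong-≋ λ e → solve 3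
              (λ x t v → t :* t :* (v :* v) := (x :- (x :+ t :* v)) :* (x :- (x :+ t :* v)))
              refl (x e) t (v e))) ⟩
        _ ∎

  affineHull-line : ∀ S {z} {p q : Point} t → S p → S q →
                    (∀ e → z e ≈ p e + t * (q e - p e)) → AffineHull S z
  affineHull-line S {z} {p} {q} t Sp Sq z≈ =
    2 , ((1# - t) Vector.∷ t Vector.∷ Vector.[]) , (p Vector.∷ q Vector.∷ Vector.[]) ,
    (λ { zero → Sp ; (suc zero) → Sq }) ,
    solve 1 (λ t → con (+ 1) :- t :+ (t :+ con (+ 0)) := con (+ 1)) refl t ,
    λ e → trans (z≈ e) (solve 3 (λ p q t → p :+ t :* (q :- p) :=
      (con (+ 1) :- t) :* p :+ (t :* q :+ con (+ 0))) refl (p e) (q e) t)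

  affineHull-mono : ∀ S T {x} → S ⊆ T → AffineHull S x → AffineHull T x
  affineHull-mono S T S⊆T (k , c , p , Sp , c≈1 , x≈) = k , c , p , (λ r → S⊆T {p r} (Sp r)) , c≈1 , x≈

  relativeInterior-resp : ∀ S T {x} → S ≐ T → RelativeInterior S x → RelativeInterior T x
  relativeInterior-resp S T {x} (S⊆T , T⊆S) (Sx , ε , 0<ε , ball) =
    S⊆T {x} Sx , ε , 0<ε , λ {y} hull near → S⊆T {y} (ball {y} (affineHull-mono T S {y} T⊆S hull) near)

  closure-mono : ∀ S T {x} → S ⊆ T → Closure S x → Closure T x
  closure-mono S T S⊆T x∈ 0<ε = let (y , Sy , near) = x∈ 0<ε in y , S⊆T {y} Sy , near

  -- The segment from y to a relatively interior point x can be prolonged a little beyond x inside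
  -- S, because the new point lies on the line through x and y and hence in the affine hull.
  relativeInterior-extend : ∀ S {x y} → RelativeInterior S x → S y →
                            ∃ λ t → 0# < t × S (x +[ t ] (x +[ - 1# ] y))
  relativeInterior-extend S {x} {y} (Sx , ε , 0<ε , ball) Sy
    with small-witness (within-small x (x +[ - 1# ] y) 0<ε)
  ... | t , 0<t , near = t , 0<t ,
    ball {x +[ t ] (x +[ - 1# ] y)} (affineHull-line S {p = x} {y} (- t) Sx Sy (λ e →
      solve 3 (λ x y t → x :+ t :* (x :+ :- con (+ 1) :* y) := x :+ :- t :* (y :- x)) refl (x e) (y e) t)) near

  -- Starting at a point p of the cone, a short step towards an arbitrary x keeps all strict
  -- inequalities; x then lies on the line through p and the end of that step, at parameter 1/t.
  openPolyhedralCone⇒fullDimensional : ∀ {S} → IsOpenPolyhedralCone S → Satisfiable S →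
                                       FullDimensional S
  openPolyhedralCone⇒fullDimensional {S} (as , _ , S⊆ , ⊆S) (p , Sp) x
    with small-witness (small-All {P = λ a t → 0# < a · p → 0# < a · (p +[ t ] w)} stays as)
    where
    w = x +[ - 1# ] p
    -- An implication, since `small-All` asks for every vector and not only for those in `as`.
    stays : ∀ a → Small (λ t → 0# < a · p → 0# < a · (p +[ t ] w))
    stays a with excludedMiddle (0# < a · p)
    ... | yes 0<ap = small-map (λ {t} _ h _ → <-respʳ-≈ (sym (·-linearʳ a p t w)) h)
                       (small-perturbation (a · w) 0<ap)
    ... | no  ap≤0 = 1# , 0<1 , λ _ _ 0<ap → contradiction 0<ap ap≤0
  ... | t , 0<t , stays with inverse-pos 0<t
  ...   | s , _ , ts≈1 = affineHull-line S {p = p} {p +[ t ] (x +[ - 1# ] p)} s Sp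
          (⊆S (All.zipWith (λ (h , 0<) → h 0<) (stays , S⊆ Sp))) λ e → begin
    x e                                        ≈⟨ solve 2 (λ x p → x := p :+ con (+ 1) :* (x :- p)) refl (x e) (p e) ⟩
    p e + 1# * (x e - p e)                     ≈⟨ +-congˡ (*-congʳ ts≈1) ⟨
    p e + t * s * (x e - p e)                  ≈⟨ solve 4 (λ x p s t → p :+ t :* s :* (x :- p) :=
      p :+ s :* (p :+ t :* (x :+ :- con (+ 1) :* p) :- p)) refl (x e) (p e) s t ⟩
    p e + s * (p e + t * (x e + - 1# * p e) - p e) ∎

  isFaceOf-resp : ∀ {F F′ S S′} → F ≐ F′ → S ≐ S′ → F IsFaceOf S → F′ IsFaceOf S′
  isFaceOf-resp (F⊆F′ , F′⊆F) (S⊆S′ , S′⊆S) (u , c , valid , F⊆ , ⊆F) =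
    u , c , (λ S′x → valid (S′⊆S S′x)) ,
    (λ F′x → let (Sx , ux≈c) = F⊆ (F′⊆F F′x) in S⊆S′ Sx , ux≈c) ,
    (λ (S′x , ux≈c) → F⊆F′ (⊆F (S′⊆S S′x , ux≈c)))

-- Finite enumerations and decidable subsets

Listing : Set → Set
Listing A = Σ[ as ∈ List A ] ∀ a → a ∈ as

listing-Fin : ∀ n → Listing (Fin n)
listing-Fin n = allFin n , ∈-allFin

listing-Σ : ∀ {A : Set} {B : A → Set} → Listing A → (∀ a → Listing (B a)) → Listing (Σ A B)
listing-Σ (as , a∈as) Bs =
  concatMap (λ a → List.map (a ,_) (proj₁ (Bs a))) as ,
  λ (a , b) → ∈-concatMap⁺ _ (lose (a∈as a) (∈-map⁺ (a ,_) (proj₂ (Bs a) b)))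

listing-⊎ : ∀ {A B : Set} → Listing A → Listing B → Listing (A ⊎ B)
listing-⊎ (as , a∈as) (bs , b∈bs) = List.map inj₁ as List.++ List.map inj₂ bs , λ where
  (inj₁ a) → ∈-++⁺ˡ (∈-map⁺ inj₁ (a∈as a))
  (inj₂ b) → ∈-++⁺ʳ (List.map inj₁ as) (∈-map⁺ inj₂ (b∈bs b))

listing-image : ∀ {A B : Set} (f : A → B) → (∀ b → ∃ λ a → f a ≡ b) → Listing A → Listing B
listing-image f surjective (as , a∈as) = List.map f as , λ b →
  let (a , fa≡b) = surjective b in ≡.subst (_∈ List.map f as) fa≡b (∈-map⁺ f (a∈as a))

sublists : ∀ {A : Set} → List A → List (List A)
sublists []       = [] ∷ []
sublists (a ∷ as) = List.map (a ∷_) (sublists as) List.++ sublists as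

-- The source of the finiteness of the fan: a cell is determined by the list of its critical paths,
-- which is a filtered list of all paths.
filter∈sublists : ∀ {A : Set} {P : A → Set} (P? : ∀ a → Dec (P a)) as →
                  List.filter P? as ∈ sublists as
filter∈sublists P? [] = here ≡.refl
filter∈sublists P? (a ∷ as) with does (P? a)
... | true  = ∈-++⁺ˡ (∈-map⁺ (a ∷_) (filter∈sublists P? as))
... | false = ∈-++⁺ʳ _ (filter∈sublists P? as)

module _ {n} {P : Fin n → Set} (P? : ∀ v → Dec (P v)) where

  fromDecidable : Subset n
  fromDecidable = Vec.tabulate (does ∘ P?)

  ∈-fromDecidable⁺ : ∀ {v} → P v → v Subset.∈ fromDecidable
  ∈-fromDecidable⁺ {v} Pv =
    Vec.lookup⇒[]= v _ (≡.trans (Vec.lookup∘tabulate _ v) (dec-true (P? v) Pv))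

  ∈-fromDecidable⁻ : ∀ {v} → v Subset.∈ fromDecidable → P v
  ∈-fromDecidable⁻ {v} v∈ with P? v
    | ≡.trans (≡.sym (Vec.lookup∘tabulate (does ∘ P?) v)) (Vec.[]=⇒lookup v∈)
  ... | yes Pv | _ = Pv
  ... | no _   | ()

-- Paths in a finite DAG

module DAGProperties (G : DAG) where
  open DAG G

  ⟶-irrelevant : ∀ {i j} (e e′ : i ⟶ j) → e ≡ e′
  ⟶-irrelevant (e , ≡.refl , ≡.refl) (e′ , p , q) with simple {e} {e′} (≡.sym p) (≡.sym q)
  ⟶-irrelevant (e , ≡.refl , ≡.refl) (e , ≡.refl , ≡.refl) | ≡.refl = ≡.refl

  ⟶-unique : ∀ {e i j i′ j′} → src e ≡ i × tgt e ≡ j → src e ≡ i′ × tgt e ≡ j′ → i ≡ i′ × j ≡ j′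
  ⟶-unique (≡.refl , ≡.refl) (≡.refl , ≡.refl) = ≡.refl , ≡.refl

  Path-isStrictPartialOrder : IsStrictPartialOrder _≡_ Path
  Path-isStrictPartialOrder = record
    { isEquivalence = ≡.isEquivalence
    ; irrefl        = λ { ≡.refl → acyclic }
    ; trans         = _++_
    ; <-resp-≈      = ≡.resp₂ Path
    }

  Path-wellFounded : WellFounded Path
  Path-wellFounded = Fin.spo-wellFounded Path-isStrictPartialOrder

  Path-noetherian : WellFounded (flip Path)
  Path-noetherian = Fin.spo-noetherian Path-isStrictPartialOrder

  listing-⟶ : ∀ i j → Listing (i ⟶ j)
  listing-⟶ i j with Fin.any? (λ e → (src e Fin.≟ i) ×-dec (tgt e Fin.≟ j))
  ... | yes e  = e ∷ [] , λ e′ → here (⟶-irrelevant e′ e)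
  ... | no  ∄e = [] , λ e → contradiction e ∄e

  -- A path is an edge, or an edge followed by a path from a successor of `i`. The recursion ends
  -- because moving forward along paths in a finite DAG is well-founded.
  listing-Path : ∀ {i} → Acc (flip Path) i → ∀ j → Listing (Path i j)
  listing-Path {i} (acc rec) j = listing-image fromSum surjective
    (listing-⊎ (listing-⟶ i j)
      (listing-Σ (listing-Fin #V) λ k → listing-Σ (listing-⟶ i k) λ e → listing-Path (rec [ e ]) j))
    where
    fromSum : i ⟶ j ⊎ (Σ V λ k → Σ (i ⟶ k) λ _ → Path k j) → Path i j
    fromSum (inj₁ e)           = [ e ]
    fromSum (inj₂ (_ , e , π)) = e ∷ π

    surjective : ∀ π → ∃ λ s → fromSum s ≡ π
    surjective [ e ]   = inj₁ e , ≡.refl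
    surjective (e ∷ π) = inj₂ (_ , e , π) , ≡.refl

  ∈-interior⁻ : ∀ {i j k} (π : Path i j) → k ∈ interior π →
                ∃₂ λ (α : Path i k) (β : Path k j) → π ≡ α ++ β
  ∈-interior⁻ (e ∷ π) (here ≡.refl)  = [ e ] , π , ≡.refl
  ∈-interior⁻ (e ∷ π) (there k∈π) with ∈-interior⁻ π k∈π
  ... | α , β , ≡.refl = e ∷ α , β , ≡.refl

  interior-< : ∀ {i j k} {π : Path i j} → k ∈ interior π → Path i k
  interior-< {π = π} k∈π = proj₁ (∈-interior⁻ π k∈π)

  interior-> : ∀ {i j k} {π : Path i j} → k ∈ interior π → Path k j
  interior-> {π = π} k∈π = proj₁ (proj₂ (∈-interior⁻ π k∈π))

  -- Decidability is an argument because excluded middle is derived from the real numbers, which are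
  -- absent from this module.
  minimal : ∀ {S : V → Set} → (∀ v → Dec (∃ λ k → Path k v × S k)) → ∀ {v} → S v →
            ∃ λ k → S k × (∀ {k′} → Path k′ k → ¬ S k′)
  minimal {S} below? = go (Path-wellFounded _)
    where
    go : ∀ {v} → Acc Path v → S v → ∃ λ k → S k × (∀ {k′} → Path k′ k → ¬ S k′)
    go {v} (acc rec) Sv with below? v
    ... | yes (k , k<v , Sk) = go (rec k<v) Sk
    ... | no  none           = v , Sv , λ k<v Sk → none (_ , k<v , Sk)

-- Path weights as linear functionals

module UnitVectors (ℝ : RealNumbers) where
  open RealNumbers ℝ hiding (zero)
  open SetoidReasoning setoid
  open CommutativeMonoidSum +-commutativeMonoid using (sum; sum-cong-≋; sum-replicate-zero)

  unit : ∀ {n} → Fin n → Vector Carrier n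
  unit e f = if does (e Fin.≟ f) then 1# else 0#

  unit-≢ : ∀ {n} {e f : Fin n} → e ≢ f → unit e f ≡ 0#
  unit-≢ {e = e} {f} e≢f with e Fin.≟ f
  ... | yes e≡f = contradiction e≡f e≢f
  ... | no  _   = ≡.refl

  unit-self : ∀ {n} (e : Fin n) → unit e e ≡ 1#
  unit-self e with e Fin.≟ e
  ... | yes _   = ≡.refl
  ... | no  e≢e = contradiction ≡.refl e≢e

  sum-unit : ∀ {n} (e : Fin n) (x : Vector Carrier n) → sum (λ f → unit e f * x f) ≈ x e
  sum-unit {suc n} zero x = begin
    1# * x zero + sum (λ f → 0# * x (suc f)) ≈⟨ +-cong (*-identityˡ _) (sum-cong-≋ (λ f → zeroˡ (x (suc f)))) ⟩
    x zero + sum {n} (λ _ → 0#)              ≈⟨ +-congˡ (sum-replicate-zero n) ⟩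
    x zero + 0#                              ≈⟨ +-identityʳ _ ⟩
    x zero                                   ∎
  sum-unit {suc n} (suc e) x = begin
    0# * x zero + sum (λ f → unit e f * x (suc f)) ≈⟨ +-cong (zeroˡ _) (sum-unit e (λ f → x (suc f))) ⟩
    0# + x (suc e)                                 ≈⟨ +-identityˡ _ ⟩
    x (suc e)                                      ∎

module PathWeights (ℝ : RealNumbers) (G : DAG) where
  open RealNumbers ℝ hiding (zero)
  open RealProperties ℝ
  open Maxoids ℝ G
  open GeometryProperties ℝ #E
  open DAGProperties G
  open UnitVectors ℝ
  open SetoidReasoning setoid
  open CommutativeMonoidSum +-commutativeMonoid using (sum; sum-cong-≋; ∑-distrib-+)

  indicator : ∀ {i j} → Path i j → Point
  indicator [ e , _ ]     = unit e
  indicator ((e , _) ∷ π) = unit e +[ 1# ] indicator π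

  indicator-· : ∀ {i j} (π : Path i j) C → indicator π · C ≈ ω C π
  indicator-· [ e , _ ]     C = sum-unit e C
  indicator-· ((e , _) ∷ π) C = begin
    (unit e +[ 1# ] indicator π) · C       ≈⟨ ·-linearˡ (unit e) 1# (indicator π) C ⟩
    unit e · C + 1# * (indicator π · C)    ≈⟨ +-cong (sum-unit e C) (*-identityˡ _) ⟩
    C e + indicator π · C                  ≈⟨ +-congˡ (indicator-· π C) ⟩
    C e + ω C π                            ∎

  -- Every edge of π leaves a node that can be reached from i, so an edge of π leaving i itself
  -- would close a cycle.
  indicator-upstream : ∀ {i k j} e → src e ≡ i → Path i k → (π : Path k j) → indicator π e ≈ 0#
  indicator-upstream e ≡.refl i<k [ e′ , ≡.refl , _ ] =
    reflexive (unit-≢ {e = e′} {e} λ { ≡.refl → acyclic i<k })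
  indicator-upstream e ≡.refl i<k ((e′ , ≡.refl , q) ∷ π) = begin
    unit e′ e + 1# * indicator π e   ≈⟨ +-cong (reflexive (unit-≢ {e = e′} {e} λ { ≡.refl → acyclic i<k }))
                                          (*-congˡ (indicator-upstream e ≡.refl (i<k ++ [ e′ , ≡.refl , q ]) π)) ⟩
    0# + 1# * 0#                     ≈⟨ +-identityˡ _ ⟩
    1# * 0#                          ≈⟨ zeroʳ 1# ⟩
    0#                               ∎

  -- By acyclicity, no later edge of a path leaves its source.
  indicator-head : ∀ {i k j} e e′ (p : src e ≡ i × tgt e ≡ k) (p′ : src e′ ≡ i) (π : Path k j) →
                   indicator ((e , p) ∷ π) e′ ≈ unit e e′
  indicator-head e e′ p p′ π = begin
    unit e e′ + 1# * indicator π e′   ≈⟨ +-congˡ (*-congˡ (indicator-upstream e′ p′ [ e , p ] π)) ⟩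
    unit e e′ + 1# * 0#               ≈⟨ +-congˡ (zeroʳ 1#) ⟩
    unit e e′ + 0#                    ≈⟨ +-identityʳ _ ⟩
    unit e e′                         ∎

  1≉0 : ¬ (1# ≈ 0#)
  1≉0 1≈0 = irrefl (sym 1≈0) 0<1

  unit≈1 : ∀ (e e′ : E) → unit e e′ ≈ 1# → e ≡ e′
  unit≈1 e e′ eq with e Fin.≟ e′
  ... | yes e≡e′ = e≡e′
  ... | no  _    = contradiction (sym eq) 1≉0

  -- A path has exactly one edge out of its source, so the indicator reveals the first edge; the
  -- rest follows by induction, and a path that stops while the other goes on would leave a cycle.
  -- This makes the normals of the hyperplanes nonzero.
  indicator-injective : ∀ {i j} (π π′ : Path i j) → (∀ e → indicator π e ≈ indicator π′ e) → π ≡ π′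
  indicator-injective [ e ] [ e′ ] _ = ≡.cong [_] (⟶-irrelevant e e′)
  indicator-injective [ e , p ] ((e′ , p′) ∷ π′) eq with
    unit≈1 e′ e (trans (sym (indicator-head e′ e p′ (proj₁ p) π′))
      (trans (sym (eq e)) (reflexive (unit-self e))))
  ... | ≡.refl with ⟶-unique {e} p p′
  ...   | _ , ≡.refl = contradiction π′ acyclic
  indicator-injective ((e , p) ∷ π) [ e′ , p′ ] eq with
    unit≈1 e e′ (trans (sym (indicator-head e e′ p (proj₁ p′) π))
      (trans (eq e′) (reflexive (unit-self e′))))
  ... | ≡.refl with ⟶-unique {e} p p′
  ...   | _ , ≡.refl = contradiction π acyclic
  indicator-injective ((e , p) ∷ π) ((e′ , p′) ∷ π′) eq with
    unit≈1 e e′ (trans (sym (indicator-head e e′ p (proj₁ p′) π)) (trans (eq e′)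
      (trans (indicator-head e′ e′ p′ (proj₁ p′) π′) (reflexive (unit-self e′)))))
  ... | ≡.refl with ⟶-unique {e} p p′
  ...   | _ , ≡.refl = ≡.cong₂ _∷_ (⟶-irrelevant _ _) (indicator-injective π π′ λ f →
          x-y≈0⇒x≈y (begin
            indicator π f - indicator π′ f ≈⟨ solve 3 (λ u a b → a :- b :=
              u :+ con (+ 1) :* a :- (u :+ con (+ 1) :* b)) refl (unit e f) _ _ ⟩
            (unit e f + 1# * indicator π f) - (unit e f + 1# * indicator π′ f) ≈⟨ +-congʳ (eq f) ⟩
            (unit e f + 1# * indicator π′ f) - (unit e f + 1# * indicator π′ f) ≈⟨ -‿inverseʳ _ ⟩
            0# ∎))

  difference : ∀ {i j} → Path i j → Path i j → Point
  difference π π′ = indicator π +[ - 1# ] indicator π′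

  difference-· : ∀ {i j} (π π′ : Path i j) C → difference π π′ · C ≈ ω C π - ω C π′
  difference-· π π′ C = begin
    difference π π′ · C                          ≈⟨ ·-linearˡ (indicator π) (- 1#) (indicator π′) C ⟩
    indicator π · C + - 1# * (indicator π′ · C)  ≈⟨ solve 2 (λ a b → a :+ :- con (+ 1) :* b := a :- b) refl _ _ ⟩
    indicator π · C - indicator π′ · C           ≈⟨ +-cong (indicator-· π C) (-‿cong (indicator-· π′ C)) ⟩
    ω C π - ω C π′                               ∎

  difference-nonZero : ∀ {i j} {π π′ : Path i j} → π ≢ π′ → NonZeroVector (difference π π′)
  difference-nonZero {π = π} {π′} π≢π′ ≈0 = π≢π′ (indicator-injective π π′ λ e →
    x-y≈0⇒x≈y (trans (solve 2 (λ a b → a :- b := a :+ :- con (+ 1) :* b) refl _ _) (≈0 e)))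

  ω-linear : ∀ {i j} C t D (π : Path i j) → ω (C +[ t ] D) π ≈ ω C π + t * ω D π
  ω-linear C t D π = begin
    ω (C +[ t ] D) π                          ≈⟨ indicator-· π _ ⟨
    indicator π · (C +[ t ] D)                ≈⟨ ·-linearʳ (indicator π) C t D ⟩
    indicator π · C + t * (indicator π · D)   ≈⟨ +-cong (indicator-· π C) (*-congˡ (indicator-· π D)) ⟩
    ω C π + t * ω D π                         ∎

  ω-affine : ∀ {i j k} (c : Vector Carrier k) (p : Vector Point k) {x} →
             (∀ e → x e ≈ sum (λ r → c r * p r e)) →
             (π : Path i j) → ω x π ≈ sum (λ r → c r * ω (p r) π)
  ω-affine c p x≈ [ e , _ ] = x≈ e
  ω-affine c p {x} x≈ ((e , _) ∷ π) = begin
    x e + ω x π                                                 ≈⟨ +-cong (x≈ e) (ω-affine c p x≈ π) ⟩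
    sum (λ r → c r * p r e) + sum (λ r → c r * ω (p r) π)
      ≈⟨ ∑-distrib-+ (λ r → c r * p r e) (λ r → c r * ω (p r) π) ⟨
    sum (λ r → c r * p r e + c r * ω (p r) π)                   ≈⟨ sum-cong-≋ (λ r → sym (distribˡ (c r) _ _)) ⟩
    sum (λ r → c r * (p r e + ω (p r) π))                       ∎

  -- Counted in the field because it serves as a Lipschitz constant: points at distance less than ε
  -- differ by less than ε in each coordinate.
  length : ∀ {i j} → Path i j → Carrier
  length [ _ ]   = 1#
  length (_ ∷ π) = 1# + length π

  ω-lipschitz : ∀ {i j ε x y} (π : Path i j) → 0# < ε → Within ε x y → ω x π < ω y π + length π * ε
  ω-lipschitz {ε = ε} {x} {y} [ e , _ ] 0<ε near =
    <-respʳ-≈ (+-congˡ (sym (*-identityˡ ε))) (within-coordinate {x = x} {y} 0<ε near e)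
  ω-lipschitz {ε = ε} {x} {y} ((e , _) ∷ π) 0<ε near = 0<y-x⇒x<y (<-respʳ-≈
    (solve 6 (λ x y ε wx wy l → (y :+ ε :- x) :+ (wy :+ l :* ε :- wx) :=
        y :+ wy :+ (con (+ 1) :+ l) :* ε :- (x :+ wx)) refl (x e) (y e) ε (ω x π) (ω y π) (length π))
    (+-pos (x<y⇒0<y-x (within-coordinate {x = x} {y} 0<ε near e))
      (x<y⇒0<y-x (ω-lipschitz {x = x} {y} π 0<ε near))))

-- Cells: matrices retaining given critical paths

module Cells (ℝ : RealNumbers) (G : DAG) where
  open RealNumbers ℝ hiding (zero)
  open RealProperties ℝ
  open Maxoids ℝ G
  open GeometryProperties ℝ #E
  open DAGProperties G
  open PathWeights ℝ G
  open SetoidReasoning setoid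
  open CommutativeMonoidSum +-commutativeMonoid using (sum; sum-cong-≋)

  private
    ≤-totalOrder : TotalOrder 0ℓ 0ℓ 0ℓ
    ≤-totalOrder = record { isTotalOrder = ToNonStrict.isTotalOrder _≈_ _<_ isStrictTotalOrder }

  AnyPath : Set
  AnyPath = Σ V λ i → Σ V λ j → Path i j

  ParallelPaths : Set
  ParallelPaths = Σ V λ i → Σ V λ j → Path i j × Path i j

  paths : ∀ i j → Listing (Path i j)
  paths i = listing-Path (Path-noetherian i)

  anyPaths : Listing AnyPath
  anyPaths = listing-Σ (listing-Fin #V) λ i → listing-Σ (listing-Fin #V) λ j → paths i j

  parallelPaths : Listing ParallelPaths
  parallelPaths = listing-Σ (listing-Fin #V) λ i → listing-Σ (listing-Fin #V) λ j →
    listing-Σ (paths i j) λ _ → paths i j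

  abstract
    -- The argument `π` shows that some path exists and is the starting value of `argmax`. Being
    -- abstract, the chosen path is known only through `best-critical`.
    best : ∀ (C : WeightMatrix) {i j} → Path i j → Path i j
    best C {i} {j} π = Extrema.argmax ≤-totalOrder (ω C) π (proj₁ (paths i j))

    best-critical : ∀ C {i j} (π : Path i j) → Critical C (best C π)
    best-critical C {i} {j} π π′ = All.lookup
      (Extrema.f[xs]≤f[argmax] ≤-totalOrder {f = ω C} π (proj₁ (paths i j))) (proj₂ (paths i j) π′)

  critical-≈ : ∀ C {i j} (π π′ : Path i j) → Critical C π → Critical C π′ → ω C π ≈ ω C π′
  critical-≈ C π π′ π-crit π′-crit = ≤-antisym (π′-crit π) (π-crit π′)

  critical-≤ : ∀ C {i j} (π π′ : Path i j) → Critical C π → ω C π ≤ ω C π′ → Critical C π′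
  critical-≤ C π π′ π-crit π≤π′ ρ = ≤-trans (π-crit ρ) π≤π′

  noncritical-< : ∀ C {i j} (π π′ : Path i j) → Critical C π → ¬ Critical C π′ → ω C π′ < ω C π
  noncritical-< C π π′ π-crit ¬π′-crit = ≰⇒> λ π≤π′ → ¬π′-crit (critical-≤ C π π′ π-crit π≤π′)

  Cell : WeightMatrix → ConeSet
  Cell C D = ∀ {i j} (π : Path i j) → Critical C π → Critical D π

  OpenCell : WeightMatrix → ConeSet
  OpenCell C D = Cell C D × Cell D C

  critical-+ : ∀ {i j} x y {t} (π : Path i j) → 0# ≤ t →
               Critical x π → Critical y π → Critical (x +[ t ] y) π
  critical-+ x y {t} π 0≤t x-crit y-crit π′ = 0≤y-x⇒x≤y (≤-respʳ-≈ eq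
    (+-nonneg (x≤y⇒0≤y-x (x-crit π′)) (*-nonneg 0≤t (x≤y⇒0≤y-x (y-crit π′)))))
    where
    eq : ω x π - ω x π′ + t * (ω y π - ω y π′) ≈ ω (x +[ t ] y) π - ω (x +[ t ] y) π′
    eq = begin
      ω x π - ω x π′ + t * (ω y π - ω y π′)           ≈⟨ solve 5 (λ a b c d t →
        a :- b :+ t :* (c :- d) := a :+ t :* c :- (b :+ t :* d)) refl _ _ _ _ t ⟩
      (ω x π + t * ω y π) - (ω x π′ + t * ω y π′)     ≈⟨ +-cong (ω-linear x t y π) (-‿cong (ω-linear x t y π′)) ⟨
      ω (x +[ t ] y) π - ω (x +[ t ] y) π′            ∎

  -- A path critical in both summands exists and beats every path that is not.
  critical-+⁻ : ∀ {i j} D x y {t} (π : Path i j) → 0# < t → Cell D x → Cell D y →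
                Critical (x +[ t ] y) π → Critical x π × Critical y π
  critical-+⁻ D x y {t} π 0<t Dx Dy crit =
    critical-≤ x ρ π x-crit (≮⇒≥ λ x< → absurd
      (+-pos-nonneg (x<y⇒0<y-x x<) (*-nonneg (<⇒≤ 0<t) (x≤y⇒0≤y-x (y-crit π))))) ,
    critical-≤ y ρ π y-crit (≮⇒≥ λ y< → absurd
      (+-nonneg-pos (x≤y⇒0≤y-x (x-crit π)) (*-pos 0<t (x<y⇒0<y-x y<))))
    where
    ρ = best D π
    x-crit = Dx ρ (best-critical D π)
    y-crit = Dy ρ (best-critical D π)

    absurd : ¬ (0# < ω x ρ - ω x π + t * (ω y ρ - ω y π))
    absurd pos = <⇒≱ (0<y-x⇒x<y (<-respʳ-≈ eq pos)) (crit ρ)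
      where
      eq : ω x ρ - ω x π + t * (ω y ρ - ω y π) ≈ ω (x +[ t ] y) ρ - ω (x +[ t ] y) π
      eq = begin
        ω x ρ - ω x π + t * (ω y ρ - ω y π)           ≈⟨ solve 5 (λ a b c d t →
          a :- b :+ t :* (c :- d) := a :+ t :* c :- (b :+ t :* d)) refl _ _ _ _ t ⟩
        (ω x ρ + t * ω y ρ) - (ω x π + t * ω y π)     ≈⟨ +-cong (ω-linear x t y ρ) (-‿cong (ω-linear x t y π)) ⟨
        ω (x +[ t ] y) ρ - ω (x +[ t ] y) π           ∎

  cell-+ : ∀ D x y {t} → 0# ≤ t → Cell D x → Cell D y → Cell D (x +[ t ] y)
  cell-+ D x y 0≤t Dx Dy π crit = critical-+ x y π 0≤t (Dx π crit) (Dy π crit)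

  gap-persists : ∀ {i j} x (π π′ : Path i j) → ω x π < ω x π′ →
                 Small (λ ε → ∀ y → Within ε x y → ω y π < ω y π′)
  gap-persists x π π′ gap = small-map close
    (small-perturbation (- (length π + length π′)) (x<y⇒0<y-x gap))
    where
    close : ∀ {ε} → 0# < ε → 0# < ω x π′ - ω x π + ε * - (length π + length π′) →
            ∀ y → Within ε x y → ω y π < ω y π′
    close {ε} 0<ε bound y near = 0<y-x⇒x<y (<-respʳ-≈
      (solve 7 (λ xπ xπ′ yπ yπ′ l l′ ε →
        (xπ′ :- xπ :+ ε :* :- (l :+ l′)) :+ ((xπ :+ l :* ε :- yπ) :+ (yπ′ :+ l′ :* ε :- xπ′)) := yπ′ :- yπ)
        refl (ω x π) (ω x π′) (ω y π) (ω y π′) (length π) (length π′) ε)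
      (+-pos bound (+-pos
        (x<y⇒0<y-x (ω-lipschitz {x = y} {x} π 0<ε (within-sym {x = x} {y} near)))
        (x<y⇒0<y-x (ω-lipschitz {x = x} {y} π′ 0<ε near)))))

  -- A violated inequality at x would persist near x, so limits stay in the cell. Conversely, adding
  -- a small positive multiple of C to a point of the cell moves it into the open cell: paths
  -- critical for the sum are critical for C.
  closure-openCell : ∀ C → Closure (OpenCell C) ≐ Cell C
  closure-openCell C = closed , dense
    where
    closed : Closure (OpenCell C) ⊆ Cell C
    closed {x} x∈ π crit π′ = ≮⇒≥ λ gap →
      let (ε , 0<ε , persists) = small-witness (gap-persists x π π′ gap)
          (y , (Cy , _) , near) = x∈ 0<ε
      in <⇒≱ (persists y near) (Cy π crit π′)

    dense : Cell C ⊆ Closure (OpenCell C)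
    dense {x} Cx 0<ε =
      let (t , 0<t , near) = small-witness (within-small x C 0<ε)
      in x +[ t ] C , (cell-+ C x C (<⇒≤ 0<t) Cx (λ _ → id) ,
           λ π crit → proj₂ (critical-+⁻ C x C π 0<t Cx (λ _ → id) crit)) , near

  -- The combinatorial trace of a small perturbation: D may break ties of C either way. Consequently
  -- a path critical for D was already critical for C.
  OrderPreserved : WeightMatrix → WeightMatrix → Set
  OrderPreserved C D = ∀ {i j} (π π′ : Path i j) → ω C π < ω C π′ → ω D π < ω D π′

  order-persists : ∀ C → ∃ λ ε → 0# < ε × ∀ D → Within ε C D → OrderPreserved C D
  order-persists C =
    let (ε , 0<ε , all) = small-witness (small-All persists (proj₁ parallelPaths))
    in ε , 0<ε , λ D near {i} {j} π π′ gap →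
         All.lookup all (proj₂ parallelPaths (i , j , π , π′)) gap D near
    where
    Persists : ParallelPaths → Carrier → Set
    Persists (_ , _ , π , π′) ε = ω C π < ω C π′ → ∀ D → Within ε C D → ω D π < ω D π′

    persists : ∀ q → Small (Persists q)
    persists (_ , _ , π , π′) with excludedMiddle (ω C π < ω C π′)
    ... | yes gap = small-map (λ _ p _ → p) (gap-persists C π π′ gap)
    ... | no ¬gap = 1# , 0<1 , λ _ _ gap → contradiction gap ¬gap

  -- Ties among the paths critical at D hold on the whole cell and, being linear equations, on its
  -- affine hull. The strict comparisons with all other paths survive in a ball around D.
  self-relativeInterior : ∀ D → RelativeInterior (Cell D) D
  self-relativeInterior D =
    let (ε , 0<ε , persists) = order-persists D
    in (λ _ → id) , ε , 0<ε , λ {z} hull near → ball z hull (persists z near)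
    where
    ball : ∀ z → AffineHull (Cell D) z → OrderPreserved D z → Cell D z
    ball z (k , c , p , Dp , _ , z≈) preserved π crit π′ with excludedMiddle (Critical D π′)
    ... | yes crit′ = inj₂ (begin
        ω z π′                          ≈⟨ ω-affine c p z≈ π′ ⟩
        sum (λ r → c r * ω (p r) π′)    ≈⟨ sum-cong-≋ (λ r →
          *-congˡ (critical-≈ (p r) π′ π (Dp r π′ crit′) (Dp r π crit))) ⟩
        sum (λ r → c r * ω (p r) π)     ≈⟨ ω-affine c p z≈ π ⟨
        ω z π                           ∎)
    ... | no ¬crit′ = inj₁ (preserved π′ π (noncritical-< D π π′ crit ¬crit′))

  -- Prolong the segment from D to x slightly beyond x, to z = (1 + t) x - t D in the cell. A path
  -- critical at x but strictly worse than ρ at D would be strictly better than ρ at z, where ρ is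
  -- still critical.
  relativeInterior⇒openCell : ∀ D x → RelativeInterior (Cell D) x → OpenCell D x
  relativeInterior⇒openCell D x x∈ = proj₁ x∈ , λ π crit →
    let ρ = best D π
        ρ-crit = best-critical D π
    in critical-≤ D ρ π ρ-crit (≮⇒≥ λ gap → <⇒≱ (0<y-x⇒x<y (<-respʳ-≈ (eq π ρ)
         (+-nonneg-pos (*-nonneg (<⇒≤ (+-pos 0<1 0<t)) (x≤y⇒0≤y-x (crit ρ)))
           (*-pos 0<t (x<y⇒0<y-x gap)))))
         (Dz ρ ρ-crit π))
    where
    extension = relativeInterior-extend (Cell D) {x} {D} x∈ (λ _ → id)
    t = proj₁ extension
    0<t = proj₁ (proj₂ extension)
    z = x +[ t ] (x +[ - 1# ] D)
    Dz : Cell D z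
    Dz = proj₂ (proj₂ extension)

    ω-z : ∀ {i j} (π : Path i j) → ω z π ≈ ω x π + t * (ω x π + - 1# * ω D π)
    ω-z π = trans (ω-linear x t (x +[ - 1# ] D) π) (+-congˡ (*-congˡ (ω-linear x (- 1#) D π)))

    eq : ∀ {i j} (π ρ : Path i j) →
         (1# + t) * (ω x π - ω x ρ) + t * (ω D ρ - ω D π) ≈ ω z π - ω z ρ
    eq π ρ = trans (solve 5 (λ xπ xρ dπ dρ t →
        (con (+ 1) :+ t) :* (xπ :- xρ) :+ t :* (dρ :- dπ) :=
        xπ :+ t :* (xπ :+ :- con (+ 1) :* dπ) :- (xρ :+ t :* (xρ :+ :- con (+ 1) :* dρ)))
        refl (ω x π) (ω x ρ) (ω D π) (ω D ρ) t)
      (sym (+-cong (ω-z π) (-‿cong (ω-z ρ))))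

  normal : ParallelPaths → Point
  normal (_ , _ , π , π′) = difference π π′

  normals : (ParallelPaths → Set) → List Point
  normals Q = List.map normal (List.filter (λ q → excludedMiddle (Q q)) (proj₁ parallelPaths))

  normals⁺ : ∀ {Q} {R : Point → Set} → (∀ q → Q q → R (normal q)) → All R (normals Q)
  normals⁺ {Q} QR = All.map⁺ (All.tabulate λ {q} q∈ →
    QR q (proj₂ (∈-filter⁻ (λ q → excludedMiddle (Q q)) {xs = proj₁ parallelPaths} q∈)))

  normals⁻ : ∀ {Q} {R : Point → Set} → All R (normals Q) → ∀ q → Q q → R (normal q)
  normals⁻ {Q} all q Qq = All.lookup all
    (∈-map⁺ normal (∈-filter⁺ (λ q → excludedMiddle (Q q)) (proj₂ parallelPaths q) Qq))

  cell-isPolyhedralCone : ∀ D → IsPolyhedralCone (Cell D)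
  cell-isPolyhedralCone D =
    normals Q ,
    normals⁺ (λ { (_ , _ , π , π′) (_ , π≢π′) → difference-nonZero {π = π} {π′} π≢π′ }) ,
    (λ {x} Dx → normals⁺ λ { (_ , _ , π , π′) (crit , _) →
      ≤-respʳ-≈ (sym (difference-· π π′ x)) (x≤y⇒0≤y-x (Dx π crit π′)) }) ,
    λ {x} all {i} {j} π crit π′ → back x all π π′ crit
    where
    -- Equal paths are left out to keep the normals nonzero; their inequality is trivial.
    Q : ParallelPaths → Set
    Q (_ , _ , π , π′) = Critical D π × π ≢ π′

    back : ∀ x → All (λ a → 0# ≤ a · x) (normals Q) → ∀ {i j} (π π′ : Path i j) →
           Critical D π → ω x π′ ≤ ω x π
    back x all π π′ crit with excludedMiddle (π ≡ π′)
    ... | yes ≡.refl = ≤-refl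
    ... | no  π≢π′   = 0≤y-x⇒x≤y (≤-respʳ-≈ (difference-· π π′ x)
                         (normals⁻ all (_ , _ , π , π′) (crit , π≢π′)))

  UniqueCritical : WeightMatrix → Set
  UniqueCritical C = ∀ {i j} (π π′ : Path i j) → Critical C π → Critical C π′ → π ≡ π′

  -- By uniqueness every comparison with the critical path is strict. Two tied critical paths would
  -- impose an equation instead, and the set would not be open.
  openCell-isOpenPolyhedralCone : ∀ C → UniqueCritical C → IsOpenPolyhedralCone (OpenCell C)
  openCell-isOpenPolyhedralCone C unique =
    normals Q , normals⁺ (λ { (_ , _ , π , π′) (crit , ¬crit′) →
      difference-nonZero {π = π} {π′} λ { ≡.refl → ¬crit′ crit } }) ,
    (λ {x} (Cx , xC) → normals⁺ λ { (_ , _ , π , π′) (crit , ¬crit′) →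
      <-respʳ-≈ (sym (difference-· π π′ x)) (x<y⇒0<y-x
        (noncritical-< x π π′ (Cx π crit) λ crit-x → ¬crit′ (xC π′ crit-x))) }) ,
    λ {x} all → (λ π crit π′ → cell x all π π′ crit) , (λ π crit → cell⁻ x all π crit)
    where
    Q : ParallelPaths → Set
    Q (_ , _ , π , π′) = Critical C π × ¬ Critical C π′

    gap : ∀ x → All (λ a → 0# < a · x) (normals Q) → ∀ {i j} (π π′ : Path i j) →
          Critical C π → ¬ Critical C π′ → ω x π′ < ω x π
    gap x all π π′ crit ¬crit′ =
      0<y-x⇒x<y (<-respʳ-≈ (difference-· π π′ x) (normals⁻ all (_ , _ , π , π′) (crit , ¬crit′)))

    cell : ∀ x → All (λ a → 0# < a · x) (normals Q) → ∀ {i j} (π π′ : Path i j) →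
           Critical C π → ω x π′ ≤ ω x π
    cell x all π π′ crit with excludedMiddle (Critical C π′)
    ... | yes crit′ = ≤-reflexive (reflexive (≡.cong (ω x) (unique π′ π crit′ crit)))
    ... | no ¬crit′ = inj₁ (gap x all π π′ crit ¬crit′)

    cell⁻ : ∀ x → All (λ a → 0# < a · x) (normals Q) → ∀ {i j} (π : Path i j) →
            Critical x π → Critical C π
    cell⁻ x all π crit with excludedMiddle (Critical C π)
    ... | yes crit′ = crit′
    ... | no ¬crit′ = contradiction (crit (best C π))
                        (<⇒≱ (gap x all (best C π) π (best-critical C π) ¬crit′))

-- Maxoids and the critical paths of generic matrices

module Identifiability (ℝ : RealNumbers) (G : DAG) where
  open RealNumbers ℝ hiding (zero)
  open RealProperties ℝ
  open Maxoids ℝ G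
  open DAGProperties G
  open Cells ℝ G

  connectingPath-mono : ∀ {C D L i j} → (∀ {k l} → CriticalEdge C L k l → CriticalEdge D L k l) →
                        ConnectingPath C L i j → ConnectingPath D L i j
  connectingPath-mono f (form-a e)                       = form-a (f e)
  connectingPath-mono f (form-b p∉L e₁ e₂)               = form-b p∉L (f e₁) (f e₂)
  connectingPath-mono f (form-c l∈L e₁ e₂)               = form-c l∈L (f e₁) (f e₂)
  connectingPath-mono f (form-d p∉L l∈L e₁ e₂ e₃)        = form-d p∉L l∈L (f e₁) (f e₂) (f e₃)
  connectingPath-mono f (form-e p∉L l∈L q∉L e₁ e₂ e₃ e₄) = form-e p∉L l∈L q∉L (f e₁) (f e₂) (f e₃) (f e₄)

  -- More critical paths mean fewer edges in the critical DAG.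
  𝓜*-mono : ∀ C D → Cell C D → ∀ {s} → 𝓜* C s → 𝓜* D s
  𝓜*-mono C D CD sep i∈I j∈J =
    λ { (inj₁ path) → sep i∈I j∈J (inj₁ (connectingPath-mono edge path))
      ; (inj₂ path) → sep i∈I j∈J (inj₂ (connectingPath-mono edge path)) }
    where
    edge : ∀ {L k l} → CriticalEdge D L k l → CriticalEdge C L k l
    edge (k≢l , π , avoids) = k≢l , π , λ ρ crit → avoids ρ (CD ρ crit)

  ω-++ : ∀ {i j k} C (α : Path i k) (β : Path k j) → ω C (α ++ β) ≈ ω C α + ω C β
  ω-++ C [ _ ]   β = refl
  ω-++ C (_ ∷ α) β = trans (+-congˡ (ω-++ C α β)) (sym (+-assoc _ _ _))

  -- A heavier replacement for either part would give a heavier concatenation.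
  critical-++⁻ : ∀ {i j k} C (α : Path i k) (β : Path k j) → Critical C (α ++ β) →
                 Critical C α × Critical C β
  critical-++⁻ C α β crit =
    (λ α′ → 0≤y-x⇒x≤y (≤-respʳ-≈ (trans (+-cong (ω-++ C α β) (-‿cong (ω-++ C α′ β)))
      (solve 3 (λ a b a′ → a :+ b :- (a′ :+ b) := a :- a′) refl _ _ _)) (x≤y⇒0≤y-x (crit (α′ ++ β))))) ,
    (λ β′ → 0≤y-x⇒x≤y (≤-respʳ-≈ (trans (+-cong (ω-++ C α β) (-‿cong (ω-++ C α β′)))
      (solve 3 (λ a b b′ → a :+ b :- (a :+ b′) := b :- b′) refl _ _ _)) (x≤y⇒0≤y-x (crit (α ++ β′)))))

  -- With L consisting of k and its ancestors other than i, the node k blocks π, and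
  -- no other form of connecting path fits: a node outside L with an edge into L is i
  -- itself, and no node of L lies below j.  Minimality of k keeps π′ clear of L.
  separator : ∀ C D → UniqueCritical D → (∀ {s} → 𝓜* C s → 𝓜* D s) →
              ∀ {i j k} (π π′ : Path i j) → Critical C π → Critical D π′ →
              k ∈ interior π → ¬ (k ∈ interior π′) → (∀ {k′} → Path k′ k → ¬ (k′ ∈ interior π′)) → ⊥
  separator C D unique C⊆D {i} {j} {k} π π′ π-crit π′-crit k∈π k∉π′ minimal-k =
    -- For `D` the critical DAG has the edge from `i` to `j`, since its only critical path `π′`
    -- avoids `L`; this contradicts the separation inherited from `C`.
    C⊆D {[i⊥j∣L]} separated (Subset.x∈⁅x⁆ i) (Subset.x∈⁅x⁆ j) (inj₁ (form-a
      ((λ { ≡.refl → acyclic π }) , π′ , λ ρ crit k′∈ρ → avoids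
        (≡.subst (λ ρ → _ ∈ interior ρ) (unique ρ π′ crit π′-crit) k′∈ρ))))
    where
    i<k : Path i k
    i<k = interior-< {π = π} k∈π
    k<j : Path k j
    k<j = interior-> {π = π} k∈π

    InL : V → Set
    InL v = v ≢ i × (v ≡ k ⊎ Path v k)

    L : Subset #V
    L = fromDecidable (λ v → excludedMiddle (InL v))

    ∈L⁺ : ∀ {v} → InL v → v Subset.∈ L
    ∈L⁺ = ∈-fromDecidable⁺ (λ v → excludedMiddle (InL v))

    ∈L⁻ : ∀ {v} → v Subset.∈ L → InL v
    ∈L⁻ = ∈-fromDecidable⁻ (λ v → excludedMiddle (InL v))

    below-L : ∀ {p l} → l Subset.∈ L → Path p l → Path p k
    below-L l∈L p<l with ∈L⁻ l∈L
    ... | _ , inj₁ ≡.refl = p<l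
    ... | _ , inj₂ l<k    = p<l ++ l<k

    parent-of-L : ∀ {p l} → p Subset.∉ L → l Subset.∈ L → Path p l → p ≡ i
    parent-of-L {p} p∉L l∈L p<l with p Fin.≟ i
    ... | yes p≡i = p≡i
    ... | no  p≢i = contradiction (∈L⁺ (p≢i , inj₂ (below-L l∈L p<l))) p∉L

    no-parent-of-i : ∀ {p} → p Subset.∉ L → ¬ Path p i
    no-parent-of-i p∉L p<i = p∉L (∈L⁺ ((λ { ≡.refl → acyclic p<i }) , inj₂ (p<i ++ i<k)))

    no-collider : ∀ {l} → l Subset.∈ L → ¬ Path j l
    no-collider l∈L j<l = acyclic (k<j ++ below-L l∈L j<l)

    no-edge : ¬ CriticalEdge C L i j
    no-edge (_ , _ , avoids) = avoids π π-crit k∈π (∈L⁺ ((λ { ≡.refl → acyclic i<k }) , inj₁ ≡.refl))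

    disconnected : ∀ {i′ j′} → i′ ≡ i → j′ ≡ j → ¬ C*-Connected C L i′ j′
    disconnected ≡.refl ≡.refl = λ where
      (inj₁ (form-a e))                                → no-edge e
      (inj₁ (form-b p∉L (_ , p<i , _) _))              → no-parent-of-i p∉L p<i
      (inj₁ (form-c l∈L _ (_ , j<l , _)))              → no-collider l∈L j<l
      (inj₁ (form-d p∉L _ (_ , p<i , _) _ _))          → no-parent-of-i p∉L p<i
      (inj₁ (form-e p∉L _ _ (_ , p<i , _) _ _ _))      → no-parent-of-i p∉L p<i
      (inj₂ (form-a (_ , j<i , _)))                    → acyclic (j<i ++ π)
      (inj₂ (form-b p∉L _ (_ , p<i , _)))              → no-parent-of-i p∉L p<i
      (inj₂ (form-c l∈L (_ , j<l , _) _))              → no-collider l∈L j<l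
      -- Besides the edge itself, the only form not excluded outright by acyclicity and the choice
      -- of `L`: here `p` must be `i`, and its edge to `j` is the one blocked by `π`.
      (inj₂ (form-d p∉L l∈L e (_ , p<l , _) _))        → no-edge
        (≡.subst (λ v → CriticalEdge C L v j) (parent-of-L p∉L l∈L p<l) e)
      (inj₂ (form-e _ _ q∉L _ _ _ (_ , q<i , _)))      → no-parent-of-i q∉L q<i

    [i⊥j∣L] : CIStatement
    [i⊥j∣L] = record
      { I = ⁅ i ⁆ ; J = ⁅ j ⁆ ; L = L
      ; I∩J≡∅ = λ v∈I v∈J → acyclic (≡.subst (Path i)
          (≡.trans (≡.sym (Subset.x∈⁅y⁆⇒x≡y j v∈J)) (Subset.x∈⁅y⁆⇒x≡y i v∈I)) π)
      ; I∩L≡∅ = λ v∈I v∈L → proj₁ (∈L⁻ v∈L) (Subset.x∈⁅y⁆⇒x≡y i v∈I)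
      ; J∩L≡∅ = λ v∈J v∈L → acyclic (k<j ++ j≤k (Subset.x∈⁅y⁆⇒x≡y j v∈J) (∈L⁻ v∈L))
      }
      where
      j≤k : ∀ {v} → v ≡ j → InL v → Path j k
      j≤k ≡.refl (_ , inj₁ ≡.refl) = k<j
      j≤k ≡.refl (_ , inj₂ j<k)    = j<k

    separated : 𝓜* C [i⊥j∣L]
    separated i′∈ j′∈ = disconnected (Subset.x∈⁅y⁆⇒x≡y i i′∈) (Subset.x∈⁅y⁆⇒x≡y j j′∈)

    avoids : ∀ {v} → v ∈ interior π′ → v Subset.∉ L
    avoids v∈π′ v∈L with ∈L⁻ v∈L
    ... | _ , inj₁ ≡.refl = k∉π′ v∈π′
    ... | _ , inj₂ v<k    = minimal-k v<k v∈π′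

  module _ {C D} (C-unique : UniqueCritical C) (D-unique : UniqueCritical D)
           (C⊆D : ∀ {s} → 𝓜* C s → 𝓜* D s) (D⊆C : ∀ {s} → 𝓜* D s → 𝓜* C s) where

    -- Cutting at a common interior node moves one end point inwards, which the accessibility
    -- arguments record. If the interiors are disjoint, the path carrying a minimal interior node
    -- decides which of the two maxoid inclusions is contradicted; if both are empty, the paths are
    -- the same edge.
    critical-agree : ∀ {i j} → Acc (flip Path) i → Acc Path j → (π π′ : Path i j) →
                       Critical C π → Critical D π′ → π ≡ π′
    critical-agree {i} {j} (acc rec-i) (acc rec-j) π π′ π-crit π′-crit
      with excludedMiddle (∃ λ m → m ∈ interior π × m ∈ interior π′)
    ... | yes (m , m∈π , m∈π′) = glue (∈-interior⁻ π m∈π) (∈-interior⁻ π′ m∈π′)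
      where
      glue : (∃₂ λ (α : Path i m) (β : Path m j) → π ≡ α ++ β) →
             (∃₂ λ (α : Path i m) (β : Path m j) → π′ ≡ α ++ β) → π ≡ π′
      glue (α , β , ≡.refl) (α′ , β′ , ≡.refl) =
        let (α-crit , β-crit)   = critical-++⁻ C α β π-crit
            (α′-crit , β′-crit) = critical-++⁻ D α′ β′ π′-crit
        in ≡.cong₂ _++_
             (critical-agree (acc rec-i) (rec-j β) α α′ α-crit α′-crit)
             (critical-agree (rec-i α) (acc rec-j) β β′ β-crit β′-crit)
    ... | no disjoint with excludedMiddle (∃ λ m → m ∈ interior π ⊎ m ∈ interior π′)
    ...   | yes (_ , m∈) with
              minimal {λ m → m ∈ interior π ⊎ m ∈ interior π′} (λ _ → excludedMiddle _) m∈
    ...     | k , inj₁ k∈π , least = ⊥-elim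
                (separator C D D-unique (λ {s} → C⊆D {s}) π π′ π-crit π′-crit k∈π
                  (λ k∈π′ → disjoint (k , k∈π , k∈π′))
                  (λ k′<k k′∈π′ → least k′<k (inj₂ k′∈π′)))
    ...     | k , inj₂ k∈π′ , least = ⊥-elim
                (separator D C C-unique (λ {s} → D⊆C {s}) π′ π π′-crit π-crit k∈π′
                  (λ k∈π → disjoint (k , k∈π , k∈π′))
                  (λ k′<k k′∈π → least k′<k (inj₁ k′∈π)))
    critical-agree _ _ [ e ] [ e′ ] _ _ | no _ | no _ = ≡.cong [_] (⟶-irrelevant e e′)
    critical-agree _ _ [ e ] (_ ∷ _) _ _ | no _ | no empty =
      contradiction (_ , inj₂ (here ≡.refl)) empty
    critical-agree _ _ (_ ∷ _) _ _ _ | no _ | no empty =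
      contradiction (_ , inj₁ (here ≡.refl)) empty

    maxoid⇒cell : Cell C D
    maxoid⇒cell {i} {j} π crit = ≡.subst (Critical D)
      (≡.sym (critical-agree (Path-noetherian i) (Path-wellFounded j) π (best D π)
        crit (best-critical D π)))
      (best-critical D π)

-- The arrangement and the cones of generic matrices

module CriticalFan (ℝ : RealNumbers) (G : DAG) where
  open RealNumbers ℝ hiding (zero)
  open RealProperties ℝ
  open Maxoids ℝ G
  open GeometryProperties ℝ #E
  open DAGProperties G
  open PathWeights ℝ G
  open Cells ℝ G
  open Identifiability ℝ G
  open SetoidReasoning setoid
  open CommutativeMonoidSum +-commutativeMonoid using (sum-cong-≋; sum-replicate-zero)

  hyperplane-isLinear : ∀ h → IsLinearHyperplane (Hyperplane h)
  hyperplane-isLinear h = difference π π′ , difference-nonZero {π = π} {π′} π≢π′ ,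
    (λ {C} tie → trans (difference-· π π′ C) (trans (+-congʳ tie) (-‿inverseʳ _))) ,
    (λ {C} ≈0 → x-y≈0⇒x≈y (trans (sym (difference-· π π′ C)) ≈0))
    where open PathPair h

  pathPairs : ParallelPaths → List PathPair
  pathPairs (_ , _ , π , π′) with excludedMiddle (π ≡ π′)
  ... | yes _    = []
  ... | no  π≢π′ = record { i≢j = λ { ≡.refl → acyclic π } ; π = π ; π′ = π′ ; π≢π′ = π≢π′ } ∷ []

  𝓗 : Arrangement
  𝓗 = concatMap pathPairs (proj₁ parallelPaths)

  unique⇒∉locus : ∀ C → UniqueCritical C → ¬ Locus 𝓗 C
  unique⇒∉locus C unique C∈ =
    let (h , _ , crit , crit′) = satisfied C∈ in PathPair.π≢π′ h (unique _ _ crit crit′)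

  ∉locus⇒unique : ∀ C → ¬ Locus 𝓗 C → UniqueCritical C
  ∉locus⇒unique C C∉ {i} {j} π π′ crit crit′ with excludedMiddle (π ≡ π′)
  ... | yes π≡π′ = π≡π′
  ... | no  π≢π′ = contradiction
    (Any.concatMap⁺ pathPairs (lose (proj₂ parallelPaths (i , j , π , π′)) tied)) C∉
    where
    tied : Any (λ h → Hyperplane h C × Critical C (PathPair.π h) × Critical C (PathPair.π′ h))
               (pathPairs (i , j , π , π′))
    tied with excludedMiddle (π ≡ π′)
    ... | yes π≡π′ = contradiction π≡π′ π≢π′
    ... | no  _    = here (critical-≈ C π π′ crit crit′ , crit , crit′)

  generic⇒unique : ∀ C → Generic C → UniqueCritical C
  generic⇒unique C generic {i} {j} π π′ crit crit′ =
    let (_ , _ , ρ≡) = generic {i} {j} (λ { ≡.refl → acyclic π }) π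
    in ≡.trans (≡.sym (ρ≡ {π} crit)) (ρ≡ {π′} crit′)

  unique⇒generic : ∀ C → UniqueCritical C → Generic C
  unique⇒generic C unique _ π =
    best C π , best-critical C π , λ {π′} crit → unique _ π′ (best-critical C π) crit

  generic⇔∉locus : ∀ C → Generic C ⇔ (¬ Locus 𝓗 C)
  generic⇔∉locus C = mk⇔ {A = Generic C} (λ generic → unique⇒∉locus C (generic⇒unique C generic))
                         (λ C∉ → unique⇒generic C (∉locus⇒unique C C∉))

  -- Forwards this is identifiability, applied in both directions to two generic matrices.
  -- Backwards, equal critical paths carry uniqueness over to D, so that D avoids the locus too.
  cone≐openCell : ∀ C → ¬ Locus 𝓗 C → cone 𝓗 C ≐ OpenCell C
  cone≐openCell C C∉ =
    (λ {D} (D∉ , C⊆D , D⊆C) →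
      let C! = ∉locus⇒unique C C∉
          D! = ∉locus⇒unique D D∉
      in (λ {i} {j} → maxoid⇒cell C! D! (λ {s} → C⊆D {s}) (λ {s} → D⊆C {s}) {i} {j}) ,
         (λ {i} {j} → maxoid⇒cell D! C! (λ {s} → D⊆C {s}) (λ {s} → C⊆D {s}) {i} {j})) ,
    (λ {D} (CD , DC) →
      unique⇒∉locus D (λ π π′ crit crit′ → ∉locus⇒unique C C∉ π π′ (DC π crit) (DC π′ crit′)) ,
      (λ {s} → 𝓜*-mono C D CD {s}) , (λ {s} → 𝓜*-mono D C DC {s}))

  closure-cone : ∀ C → ¬ Locus 𝓗 C → Closure (cone 𝓗 C) ≐ Cell C
  closure-cone C C∉ =
    (λ {x} x∈ → proj₁ (closure-openCell C)
      (closure-mono (cone 𝓗 C) (OpenCell C) {x} (proj₁ (cone≐openCell C C∉)) x∈)) ,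
    (λ {x} x∈ → closure-mono (OpenCell C) (cone 𝓗 C) {x}
      (proj₂ (cone≐openCell C C∉)) (proj₂ (closure-openCell C) x∈))

  cone-isOpenPolyhedralCone : ∀ C → ¬ Locus 𝓗 C → IsOpenPolyhedralCone (cone 𝓗 C)
  cone-isOpenPolyhedralCone C C∉ =
    let (as , nonZero , ⊆as , as⊆) = openCell-isOpenPolyhedralCone C (∉locus⇒unique C C∉)
        (cone⊆ , ⊆cone) = cone≐openCell C C∉
    in as , nonZero , (λ x∈ → ⊆as (cone⊆ x∈)) , (λ x∈ → ⊆cone (as⊆ x∈))

  cone-fullDimensional : ∀ C → ¬ Locus 𝓗 C → FullDimensional (cone 𝓗 C)
  cone-fullDimensional C C∉ =
    openPolyhedralCone⇒fullDimensional {cone 𝓗 C} (cone-isOpenPolyhedralCone C C∉)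
      (C , C∉ , id , id)

  -- Perturbation to a generic matrix

  Tied : WeightMatrix → ParallelPaths → Set
  Tied C (_ , _ , π , π′) = π ≢ π′ × ω C π ≈ ω C π′

  -- Moving along w, the difference of the two indicators, changes the weight difference at rate w ·
  -- w, which is positive because the paths are distinct.
  break-tie : ∀ C {i j} (π π′ : Path i j) → π ≢ π′ → ω C π ≈ ω C π′ →
              ∃ λ D → OrderPreserved C D × ¬ (ω D π ≈ ω D π′)
  break-tie C π π′ π≢π′ tie =
    let (ε , 0<ε , persists) = order-persists C
        (t , 0<t , near)     = small-witness (within-small C w 0<ε)
        D = C +[ t ] w
    in D , persists D near , λ tie′ → irrefl refl (<-respʳ-≈
         (begin
           t * (w · w)                            ≈⟨ +-identityˡ _ ⟨
           0# + t * (w · w)                       ≈⟨ +-congʳ (trans (+-congʳ tie) (-‿inverseʳ _)) ⟨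
           ω C π - ω C π′ + t * (w · w)           ≈⟨ +-congʳ (difference-· π π′ C) ⟨
           w · C + t * (w · w)                    ≈⟨ ·-linearʳ w C t w ⟨
           w · D                                  ≈⟨ difference-· π π′ D ⟩
           ω D π - ω D π′                         ≈⟨ +-congʳ tie′ ⟩
           ω D π′ - ω D π′                        ≈⟨ -‿inverseʳ _ ⟩
           0#                                     ∎)
         (*-pos 0<t (x·x-pos (difference-nonZero {π = π} {π′} π≢π′))))
    where w = difference π π′

  untied-preserved : ∀ {C D i j} (π π′ : Path i j) → OrderPreserved C D →
                     ¬ (ω C π ≈ ω C π′) → ¬ (ω D π ≈ ω D π′)
  untied-preserved {C} {D} π π′ preserved untied tie with compare (ω C π) (ω C π′)
  ... | tri< gap _ _ = irrefl tie (preserved π π′ gap)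
  ... | tri≈ _ tie′ _ = untied tie′
  ... | tri> _ _ gap = irrefl (sym tie) (preserved π′ π gap)

  -- Ties are broken one at a time; those already broken stay broken because each step preserves
  -- strict comparisons.
  break-ties : ∀ C qs → ∃ λ D → OrderPreserved C D × All (λ q → ¬ Tied D q) qs
  break-ties C [] = C , (λ _ _ → id) , []
  break-ties C ((i , j , π , π′) ∷ qs) with break-ties C qs
  ... | D , CD , untied with excludedMiddle (Tied D (i , j , π , π′))
  ...   | no  untied₀ = D , CD , untied₀ ∷ untied
  ...   | yes (π≢π′ , tie) =
    let (D′ , DD′ , untied₀) = break-tie D π π′ π≢π′ tie
    in D′ , (λ ρ ρ′ gap → DD′ ρ ρ′ (CD ρ ρ′ gap)) ,
       (λ (_ , tie) → untied₀ tie) ∷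
       All.map (λ { {_ , _ , ρ , ρ′} h (ρ≢ρ′ , tie) →
         untied-preserved {D} {D′} ρ ρ′ DD′ (λ tie₀ → h (ρ≢ρ′ , tie₀)) tie }) untied

  orderPreserved⇒cell : ∀ C D → OrderPreserved C D → Cell D C
  orderPreserved⇒cell C D preserved π crit π′ = ≮⇒≥ λ gap → <⇒≱ (preserved π π′ gap) (crit π′)

  generic-perturbation : ∀ D → ∃ λ C → ¬ Locus 𝓗 C × Cell C D
  generic-perturbation D =
    let (C , preserved , untied) = break-ties D (proj₁ parallelPaths)
    in C , unique⇒∉locus C (unique C untied) , (λ {i} {j} → orderPreserved⇒cell D C preserved {i} {j})
    where
    unique : ∀ C → All (λ q → ¬ Tied C q) (proj₁ parallelPaths) → UniqueCritical C
    unique C untied π π′ crit crit′ with excludedMiddle (π ≡ π′)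
    ... | yes π≡π′ = π≡π′
    ... | no  π≢π′ = contradiction (π≢π′ , critical-≈ C π π′ crit crit′)
                       (All.lookup untied (proj₂ parallelPaths (_ , _ , π , π′)))

  -- Faces of cells

  CriticalAt : WeightMatrix → AnyPath → Set
  CriticalAt C (_ , _ , π) = Critical C π

  -- Cells in terms of a finite list of paths: the form in which they can be enumerated and in which
  -- a supporting functional is built by recursion.
  AllCritical : List AnyPath → ConeSet
  AllCritical T C = All (CriticalAt C) T

  criticalPaths : WeightMatrix → List AnyPath
  criticalPaths C = List.filter (λ π → excludedMiddle (CriticalAt C π)) (proj₁ anyPaths)

  cell≐allCritical : ∀ C → Cell C ≐ AllCritical (criticalPaths C)
  cell≐allCritical C =
    (λ CD → All.tabulate λ {(i , j , π)} π∈ →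
      CD π (proj₂ (∈-filter⁻ (λ π → excludedMiddle (CriticalAt C π)) {xs = proj₁ anyPaths} π∈))) ,
    (λ all {i} {j} π crit → All.lookup all
      (∈-filter⁺ (λ π → excludedMiddle (CriticalAt C π)) (proj₂ anyPaths (i , j , π)) crit))

  origin : Point
  origin _ = 0#

  ·-zeroʳ : ∀ a → a · origin ≈ 0#
  ·-zeroʳ a = trans (sum-cong-≋ (λ e → zeroʳ (a e))) (sum-replicate-zero #E)

  origin-critical : ∀ {i j} (π : Path i j) → Critical origin π
  origin-critical π π′ = inj₂ (trans (ω≈0 π′) (sym (ω≈0 π)))
    where
    ω≈0 : ∀ {i j} (π : Path i j) → ω origin π ≈ 0#
    ω≈0 π = trans (sym (indicator-· π origin)) (·-zeroʳ (indicator π))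

  -- The functional sums, over the paths π in T, the weight of π minus that of a path ρ critical for
  -- D. On the cell ρ stays critical, so each summand is at most zero and vanishes exactly where π
  -- is critical.
  supporting : ∀ D T → ∃ λ u → ∀ x → Cell D x →
               u · x ≤ 0# × (u · x ≈ 0# → AllCritical T x) × (AllCritical T x → u · x ≈ 0#)
  supporting D [] = origin , λ x _ →
    let 0≈ = trans (·-comm origin x) (·-zeroʳ x) in inj₂ 0≈ , (λ _ → []) , (λ _ → 0≈)
  supporting D ((i , j , π) ∷ T) = u +[ 1# ] difference π ρ , supports
    where
    u = proj₁ (supporting D T)
    ρ = best D π
    supports : ∀ x → Cell D x → (u +[ 1# ] difference π ρ) · x ≤ 0# ×
               ((u +[ 1# ] difference π ρ) · x ≈ 0# → AllCritical ((i , j , π) ∷ T) x) ×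
               (AllCritical ((i , j , π) ∷ T) x → (u +[ 1# ] difference π ρ) · x ≈ 0#)
    supports x Dx =
      0≤y-x⇒x≤y (≤-respʳ-≈ slack (+-nonneg u·x≥0 π≤ρ)) ,
      (λ ≈0 →
        critical-≤ x ρ π ρ-crit (≮⇒≥ λ gap → positive⇒⊥ ≈0 (+-nonneg-pos u·x≥0 (x<y⇒0<y-x gap))) ∷
        tight⇒ (≤-antisym u·x≤0 (≮⇒≥ λ gap → positive⇒⊥ ≈0 (+-pos-nonneg (x<y⇒0<y-x gap) π≤ρ)))) ,
      (λ { (crit ∷ all) → trans value (trans
        (+-cong (⇒tight all) (trans (+-congʳ (critical-≈ x π ρ crit ρ-crit)) (-‿inverseʳ _)))
        (+-identityʳ _)) })
      where
      ρ-crit = Dx ρ (best-critical D π)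
      u·x≤0  = proj₁ (proj₂ (supporting D T) x Dx)
      tight⇒ = proj₁ (proj₂ (proj₂ (supporting D T) x Dx))
      ⇒tight = proj₂ (proj₂ (proj₂ (supporting D T) x Dx))
      u·x≥0  = x≤y⇒0≤y-x u·x≤0
      π≤ρ    = x≤y⇒0≤y-x (ρ-crit π)

      value : (u +[ 1# ] difference π ρ) · x ≈ u · x + (ω x π - ω x ρ)
      value = trans (·-linearˡ u 1# (difference π ρ) x)
        (+-congˡ (trans (*-identityˡ _) (difference-· π ρ x)))

      slack : (0# - u · x) + (ω x ρ - ω x π) ≈ 0# - (u +[ 1# ] difference π ρ) · x
      slack = trans
        (solve 3 (λ a b c → (con (+ 0) :- a) :+ (c :- b) := con (+ 0) :- (a :+ (b :- c))) refl _ _ _)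
        (+-congˡ (-‿cong (sym value)))

      positive⇒⊥ : (u +[ 1# ] difference π ρ) · x ≈ 0# → ¬ (0# < (0# - u · x) + (ω x ρ - ω x π))
      positive⇒⊥ ≈0 pos = irrefl (sym (trans slack (trans (+-congˡ (-‿cong ≈0)) (-‿inverseʳ 0#)))) pos

  cell-∩-isFaceOf : ∀ C D → (Cell C ∩ Cell D) IsFaceOf Cell C
  cell-∩-isFaceOf C D =
    let (u , supports) = supporting C (criticalPaths D)
        (D⊆ , ⊆D)      = cell≐allCritical D
    in u , 0# , (λ {x} Cx → proj₁ (supports x Cx)) ,
       (λ {x} (Cx , Dx) → Cx , proj₂ (proj₂ (supports x Cx)) (D⊆ Dx)) ,
       (λ {x} (Cx , tight) → Cx , (λ {i} {j} → ⊆D (proj₁ (proj₂ (supports x Cx)) tight) {i} {j}))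

  -- A face of a cell is the cell of any of its points at which as few paths as
  -- possible are critical; such a point is the sum of one witness for each path
  -- that is not critical on all of the face.
  face⇒cell : ∀ D {F} → F IsFaceOf Cell D → Satisfiable F → ∃ λ x → F ≐ Cell x
  face⇒cell D {F} (u , c , valid , F⊆ , ⊆F) (x₀ , Fx₀) =
    let (x , Fx , least) = fewest (proj₁ anyPaths)
    in x , (λ {y} Fy {i} {j} π crit → All.lookup least (proj₂ anyPaths (i , j , π)) crit y Fy) ,
       (λ {y} xy → cell⊆ x Fx y xy)
    where
    -- The cell contains `origin`, so 0 ≤ c, and it contains the double of `x₀`, so 2c ≤ c.
    c≈0 : c ≈ 0#
    c≈0 = ≤-antisym
      (0≤y-x⇒x≤y (≤-respʳ-≈
        (trans (+-congˡ (-‿cong (trans (·-linearʳ u x₀ 1# x₀) (+-cong u·x₀≈c (*-congˡ u·x₀≈c)))))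
          (solve 1 (λ c → c :- (c :+ con (+ 1) :* c) := con (+ 0) :- c) refl c))
        (x≤y⇒0≤y-x (valid (cell-+ D x₀ x₀ (<⇒≤ 0<1) (proj₁ (F⊆ Fx₀)) (proj₁ (F⊆ Fx₀)))))))
      (≤-respˡ-≈ (·-zeroʳ u) (valid (λ π _ → origin-critical π)))
      where u·x₀≈c = proj₂ (F⊆ Fx₀)

    F-+ : ∀ {x y} → F x → F y → F (x +[ 1# ] y)
    F-+ {x} {y} Fx Fy = let (Dx , ux≈c) = F⊆ Fx ; (Dy , uy≈c) = F⊆ Fy in
      ⊆F ((λ {i} {j} → cell-+ D x y (<⇒≤ 0<1) Dx Dy {i} {j}) , (begin
        u · (x +[ 1# ] y)     ≈⟨ ·-linearʳ u x 1# y ⟩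
        u · x + 1# * (u · y)  ≈⟨ +-cong ux≈c (trans (*-identityˡ _) (trans uy≈c c≈0)) ⟩
        c + 0#                ≈⟨ +-identityʳ c ⟩
        c                     ∎))

    fewest : ∀ πs → ∃ λ x → F x × All (λ π → CriticalAt x π → ∀ y → F y → CriticalAt y π) πs
    fewest [] = x₀ , Fx₀ , []
    fewest ((i , j , π) ∷ πs) with fewest πs | excludedMiddle (∃ λ y → F y × ¬ Critical y π)
    ... | x , Fx , least | yes (y , Fy , ¬crit) =
      x +[ 1# ] y , F-+ Fx Fy ,
      (λ crit → contradiction (proj₂ (summands π crit)) ¬crit) ∷
      All.map (λ { {_ , _ , ρ} h crit → h (proj₁ (summands ρ crit)) }) least
      where
      summands : ∀ {i j} (ρ : Path i j) → Critical (x +[ 1# ] y) ρ → Critical x ρ × Critical y ρ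
      summands ρ = critical-+⁻ D x y ρ 0<1 (proj₁ (F⊆ Fx)) (proj₁ (F⊆ Fy))
    ... | x , Fx , least | no always = x , Fx , (λ _ y Fy → crit y Fy) ∷ least
      where
      crit : ∀ y → F y → Critical y π
      crit y Fy with excludedMiddle (Critical y π)
      ... | yes crit = crit
      ... | no ¬crit = contradiction (y , Fy , ¬crit) always

    -- Beyond `x` the segment from `y` continues to a point z of the cell. The functional is at most
    -- c at `y` and z and equals c at `x` between them, so it equals c at `y`.
    cell⊆ : ∀ x → F x → ∀ y → Cell x y → F y
    cell⊆ x Fx y xy =
      let (Dx , ux≈c)   = F⊆ Fx
          (t , 0<t , xz) = relativeInterior-extend (Cell x) {x} {y} (self-relativeInterior x) xy
          Dy : Cell D y
          Dy = λ π crit → xy π (Dx π crit)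
          uy≤c = valid Dy
          uz≤c = valid (λ π crit → xz π (Dx π crit))
      in ⊆F ((λ {i} {j} → Dy {i} {j}) , ≤-antisym uy≤c (≮⇒≥ λ uy<c → <⇒≱ (0<y-x⇒x<y (<-respʳ-≈
           (begin
             t * (c - u · y)                          ≈⟨ solve 3 (λ t c a →
               t :* (c :- a) := c :+ t :* (c :+ :- con (+ 1) :* a) :- c) refl t c (u · y) ⟩
             c + t * (c + - 1# * (u · y)) - c         ≈⟨ +-congʳ (+-cong ux≈c (*-congˡ (+-congʳ ux≈c))) ⟨
             u · x + t * (u · x + - 1# * (u · y)) - c ≈⟨ +-congʳ (+-congˡ (*-congˡ (·-linearʳ u x (- 1#) y))) ⟨
             u · x + t * (u · (x +[ - 1# ] y)) - c    ≈⟨ +-congʳ (·-linearʳ u x t (x +[ - 1# ] y)) ⟨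
             u · (x +[ t ] (x +[ - 1# ] y)) - c       ∎)
           (*-pos 0<t (x<y⇒0<y-x uy<c)))) uz≤c))

  -- The fan axioms

  fan⇒cell : ∀ F → Fan 𝓗 F → ∃ λ D → F ≐ Cell D
  fan⇒cell F (C , C∉ , face , nonEmpty) =
    face⇒cell C (isFaceOf-resp {F} (id , id) (closure-cone C C∉) face) nonEmpty

  -- As D lies in the cell of the generic C, `Cell D` is contained in `Cell C`; it is thus the
  -- intersection of the two, which is a face.
  cell⇒fan : ∀ F D → F ≐ Cell D → Fan 𝓗 F
  cell⇒fan F D (F⊆ , ⊆F) =
    let (C , C∉ , CD)     = generic-perturbation D
        (closure⊆ , ⊆closure) = closure-cone C C∉
    in C , C∉ ,
       isFaceOf-resp {Cell C ∩ Cell D} {F} {Cell C} {Closure (cone 𝓗 C)}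
         ((λ {x} (_ , Dx) → ⊆F {x} Dx) ,
          (λ {x} Fx → (λ π crit → F⊆ {x} Fx π (CD π crit)) , (λ {i} {j} → F⊆ {x} Fx {i} {j})))
         ((λ {x} → ⊆closure {x}) , (λ {x} → closure⊆ {x}))
         (cell-∩-isFaceOf C D) ,
       D , ⊆F {D} (λ _ → id)

  fan-finite : ∃ λ Fs → All (Fan 𝓗) Fs × (∀ {F} → Fan 𝓗 F → Any (F ≐_) Fs)
  fan-finite =
    List.map AllCritical Ts , All.map⁺ (All.all-filter isCell? (sublists (proj₁ anyPaths))) ,
    complete
    where
    -- A sublist need not describe a cone of the fan (the empty one gives the whole space), so the
    -- unsuitable ones are discarded by excluded middle.
    isCell? : ∀ T → Dec (Fan 𝓗 (AllCritical T))
    isCell? T = excludedMiddle (Fan 𝓗 (AllCritical T))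

    Ts : List (List AnyPath)
    Ts = List.filter isCell? (sublists (proj₁ anyPaths))

    complete : ∀ {F} → Fan 𝓗 F → Any (F ≐_) (List.map AllCritical Ts)
    complete {F} F∈ =
      let (D , F⊆ , ⊆F) = fan⇒cell F F∈
          (D⊆ , ⊆D)     = cell≐allCritical D
      in lose (∈-map⁺ AllCritical (∈-filter⁺ isCell?
           (filter∈sublists (λ π → excludedMiddle (CriticalAt D π)) (proj₁ anyPaths))
           (cell⇒fan (AllCritical (criticalPaths D)) D
             ((λ {x} → ⊆D {x}) , (λ {x} → D⊆ {x})))))
         ((λ {x} Fx → D⊆ {x} (λ {i} {j} → F⊆ {x} Fx {i} {j})) ,
          (λ {x} all → ⊆F {x} (λ {i} {j} → ⊆D {x} all {i} {j})))

  fan-cones : ∀ {F} → Fan 𝓗 F → IsPolyhedralCone F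
  fan-cones {F} F∈ =
    let (D , F⊆ , ⊆F) = fan⇒cell F F∈
        (as , nonZero , D⊆ , ⊆D) = cell-isPolyhedralCone D
    in as , nonZero ,
       (λ {x} Fx → D⊆ {x} (λ {i} {j} → F⊆ {x} Fx {i} {j})) ,
       (λ {x} all → ⊆F {x} (λ {i} {j} → ⊆D {x} all {i} {j}))

  fan-faces : ∀ {F F′} → Fan 𝓗 F → F′ IsFaceOf F → Satisfiable F′ → Fan 𝓗 F′
  fan-faces {F} {F′} F∈ face nonEmpty =
    let (C , F≐C)  = fan⇒cell F F∈
        (D , F′≐D) = face⇒cell C (isFaceOf-resp {F′} (id , id) F≐C face) nonEmpty
    in cell⇒fan F′ D F′≐D

  fan-intersection : ∀ {F₁ F₂} → Fan 𝓗 F₁ → Fan 𝓗 F₂ → (F₁ ∩ F₂) IsFaceOf F₁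
  fan-intersection {F₁} {F₂} F₁∈ F₂∈ =
    let (C , ⊆C , C⊆) = fan⇒cell F₁ F₁∈
        (D , ⊆D , D⊆) = fan⇒cell F₂ F₂∈
    in isFaceOf-resp {Cell C ∩ Cell D} {F₁ ∩ F₂} {Cell C} {F₁}
         ((λ {x} (Cx , Dx) → C⊆ {x} Cx , D⊆ {x} Dx) ,
          (λ {x} (F₁x , F₂x) → (λ {i} {j} → ⊆C {x} F₁x {i} {j}) , (λ {i} {j} → ⊆D {x} F₂x {i} {j})))
         ((λ {x} → C⊆ {x}) , (λ {x} → ⊆C {x})) (cell-∩-isFaceOf C D)

  fan-isPolyhedralFan : IsPolyhedralFan (Fan 𝓗)
  fan-isPolyhedralFan = record
    { finite       = fan-finite
    ; cones        = fan-cones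
    ; nonEmpty     = λ (_ , _ , _ , nonEmpty) → nonEmpty
    ; faces        = fan-faces
    ; intersection = λ {F₁} {F₂} F₁∈ F₂∈ → fan-intersection {F₁} {F₂} F₁∈ F₂∈ ,
        isFaceOf-resp {F₂ ∩ F₁} {F₁ ∩ F₂} {F₂} {F₂} (swap , swap) (id , id)
          (fan-intersection {F₂} {F₁} F₂∈ F₁∈)
    }

  cell∈fan : ∀ D → Fan 𝓗 (Cell D)
  cell∈fan D = cell⇒fan (Cell D) D (id , id)

  fan-complete : IsComplete (Fan 𝓗)
  fan-complete x = Cell x , cell∈fan x , λ _ → id

  -- The map from cones to maxoids

  fan-relativeInterior⇒openCell : ∀ F D → F ≐ Cell D → ∀ x → RelativeInterior F x → OpenCell D x
  fan-relativeInterior⇒openCell F D F≐ x x∈ =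
    relativeInterior⇒openCell D x (relativeInterior-resp F (Cell D) {x} F≐ x∈)

  -- All relatively interior points have the critical paths of D and hence equal maxoids, so the
  -- witness chosen in `Φ` does not matter.
  Φ≐𝓜* : ∀ F D → F ≐ Cell D → ∀ C → RelativeInterior F C → Φ F ≐ 𝓜* C
  Φ≐𝓜* F D F≐ C C∈ =
    (λ {s} (C′ , C′∈ , sep) →
      let (_ , C′D) = fan-relativeInterior⇒openCell F D F≐ C′ C′∈
          (DC , _)  = fan-relativeInterior⇒openCell F D F≐ C C∈
      in 𝓜*-mono C′ C (λ π crit → DC π (C′D π crit)) {s} sep) ,
    (λ {s} sep → C , C∈ , λ {i} {j} → sep {i} {j})

  fan-relativeInterior : ∀ F → Fan 𝓗 F → Satisfiable (RelativeInterior F) ×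
                         (∀ C → RelativeInterior F C → Φ F ≐ 𝓜* C)
  fan-relativeInterior F F∈ =
    let (D , F⊆ , ⊆F) = fan⇒cell F F∈
    in (D , relativeInterior-resp (Cell D) F {D} ((λ {x} → ⊆F {x}) , (λ {x} → F⊆ {x}))
         (self-relativeInterior D)) ,
       Φ≐𝓜* F D ((λ {x} → F⊆ {x}) , (λ {x} → ⊆F {x}))

  Φ-surjective : ∀ C → ∃ λ F → Fan 𝓗 F × Φ F ≐ 𝓜* C
  Φ-surjective C = Cell C , cell∈fan C , Φ≐𝓜* (Cell C) C (id , id) C (self-relativeInterior C)

  -- A relatively interior point of the face belongs to the larger cone, so every path critical at
  -- `C₂` is critical there; `𝓜*-mono` turns additional critical paths into additional statements.
  Φ-antitone : ∀ F₁ F₂ → Fan 𝓗 F₁ → Fan 𝓗 F₂ → F₁ IsFaceOf F₂ → Φ F₁ ⊇ Φ F₂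
  Φ-antitone F₁ F₂ F₁∈ F₂∈ (_ , _ , _ , F₁⊆ , _) {s} (C₂ , C₂∈ , sep) =
    let (D₁ , F₁≐) = fan⇒cell F₁ F₁∈
        (D₂ , F₂≐) = fan⇒cell F₂ F₂∈
        ((C₁ , C₁∈) , _) = fan-relativeInterior F₁ F₁∈
        (_ , C₂D₂) = fan-relativeInterior⇒openCell F₂ D₂ F₂≐ C₂ C₂∈
        F₂C₁ = proj₁ (F₁⊆ {C₁} (proj₁ C₁∈))
    in C₁ , C₁∈ , 𝓜*-mono C₂ C₁ (λ π crit → proj₁ F₂≐ {C₁} F₂C₁ π (C₂D₂ π crit)) {s} sep

mainTheorem1 : (ℝ : RealNumbers) (G : DAG) →
    let open Maxoids ℝ G in
    Σ[ 𝓗 ∈ Arrangement ]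
    (∀ h → IsLinearHyperplane (Hyperplane h)) ×
    (∀ C → Generic C ⇔ (¬ Locus 𝓗 C)) ×
    (∀ C → ¬ Locus 𝓗 C →
    IsOpenPolyhedralCone (cone 𝓗 C) × FullDimensional (cone 𝓗 C)) ×
    IsPolyhedralFan (Fan 𝓗) × IsComplete (Fan 𝓗) ×
    (∀ F → Fan 𝓗 F →
    Satisfiable (RelativeInterior F) ×
    (∀ C → RelativeInterior F C → Φ F ≐ 𝓜* C)) ×
    (∀ C → ∃ λ F → Fan 𝓗 F × Φ F ≐ 𝓜* C) ×
    (∀ F₁ F₂ → Fan 𝓗 F₁ → Fan 𝓗 F₂ → F₁ IsFaceOf F₂ → Φ F₁ ⊇ Φ F₂)
mainTheorem1 ℝ G =
  𝓗 , hyperplane-isLinear , generic⇔∉locus ,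
  (λ C C∉ → cone-isOpenPolyhedralCone C C∉ , cone-fullDimensional C C∉) ,
  fan-isPolyhedralFan , fan-complete , fan-relativeInterior , Φ-surjective , Φ-antitone
  where open CriticalFan ℝ G
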